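{- Given a set $\mathcal{R}$ of rules on a finite set $Q$ and a subset $X\subseteq Q$, the maximum member $X^\circ$ of $\mathcal{A}(\mathcal{R})$ contained in $X$ can be computed in linear time, i.e. in time $O(l(\mathcal{R}))$.
   Context: A rule on $Q$ is a pair $(A,q)$ with $A\subseteq Q$, $q\in Q$; it accepts $Y\subseteq Q$ if $q\in Y$ implies $Y\cap A\neq\emptyset$. $\mathcal{K}(\mathcal{R})$ is the family of subsets accepted by all rules of $\mathcal{R}$, and $\mathcal{A}(\mathcal{R})$ is the family of $K\in\mathcal{K}(\mathcal{R})$ for which there is a sequence $\emptyset=Y_0\subseteq\dots\subseteq Y_k=K$ of members of $\mathcal{K}(\mathcal{R})$ with $|Y_{i+1}\setminus Y_i|=1$. $\mathcal{A}(\mathcal{R})$ is union-closed and contains $\emptyset$, so for each $X\subseteq Q$ there is a unique maximal member $X^\circ$ of $\mathcal{A}(\mathcal{R})$ contained in $X$. The input size is $l(\mathcal{R})=\sum_{(A,q)\in\mathcal{R}}(|A|+1)$, assumed to satisfy $l(\mathcal{R})\ge|Q|$. -}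

module Defs where

open import Data.Bool using (Bool; true; false; if_then_else_)
open import Data.Nat using (ℕ; zero; suc; _+_; _∸_; _≟_)
open import Data.Fin using (Fin; zero; suc; toℕ; fromℕ; inject₁)
open import Data.Fin.Subset using (Subset; _∈_; _⊆_; _∩_; _─_; ∣_∣; ⊥; Nonempty)
open import Data.List using (List; []; _∷_; _++_; map; concatMap; length)
open import Data.Nat.ListAction using (sum)
import Data.List.Membership.Propositional as List
open import Data.List.Relation.Unary.All using (All)
open import Data.List.Relation.Unary.Unique.Propositional using (Unique)
open import Data.List.Relation.Binary.Pointwise using (Pointwise)
open import Data.Product using (_×_; _,_; Σ-syntax; proj₁; proj₂)
open import Data.Vec using (lookup; toList)
open import Function using (_⇔_)
open import Relation.Binary.PropositionalEquality using (_≡_; _≢_)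
open import Relation.Nullary using (does)

------------------------------------------------------------------------
-- Rules on the finite set Q = Fin n.

Rule : ℕ → Set
Rule n = Subset n × Fin n

Accepts : ∀ {n} → Rule n → Subset n → Set
Accepts (A , q) Y = q ∈ Y → Nonempty (Y ∩ A)

-- A set of rules is a list of rules; the theorem asks for it to be
-- duplicate-free.

𝒦 : ∀ {n} → List (Rule n) → Subset n → Set
𝒦 R Y = All (λ r → Accepts r Y) R

𝒜 : ∀ {n} → List (Rule n) → Subset n → Set
𝒜 {n} R K =
  𝒦 R K ×
  Σ[ k ∈ ℕ ] Σ[ Y ∈ (Fin (suc k) → Subset n) ] (Y zero ≡ ⊥ × Y (fromℕ k) ≡ K
    × (∀ i → 𝒦 R (Y i))
    × (∀ (i : Fin k) → Y (inject₁ i) ⊆ Y (suc i)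
                     × ∣ Y (suc i) ─ Y (inject₁ i) ∣ ≡ 1))

IsMaximumIn : ∀ {n} → List (Rule n) → Subset n → Subset n → Set
IsMaximumIn R X Z =
  𝒜 R Z × Z ⊆ X × (∀ W → 𝒜 R W → W ⊆ X → W ⊆ Z)

inputSize : ∀ {n} → List (Rule n) → ℕ
inputSize R = sum (map (λ r → ∣ proj₁ r ∣ + 1) R)

------------------------------------------------------------------------
-- A random access machine with unit costs.
--
-- Memory consists of registers and arrays, both named by numerals.  The names
-- occurring in a program are constants of its text, so a program uses a fixed
-- number of them whatever its input.  Finitely many arrays can be interleaved
-- in a single memory at the cost of a constant factor.
--
-- The only operation that can increase a value is the successor.  So in t
-- steps no value exceeds the largest input word (or constant of the program)
-- by more than t, and for linear-time programs every word has O(log N) bits,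
-- N being the input length: unit costs hide no computation on large numbers.

Reg Arr : Set
Reg = ℕ
Arr = ℕ

record State : Set where
  constructor ⟪_,_⟫
  field
    reg : Reg → ℕ
    arr : Arr → ℕ → ℕ
open State public

infix 30 _⟦_≔_⟧
_⟦_≔_⟧ : ∀ {A : Set} → (ℕ → A) → ℕ → A → (ℕ → A)
(f ⟦ k ≔ v ⟧) i = if does (i ≟ k) then v else f i

infixl 40 _⊖_
data Exp : Set where
  lit    : ℕ → Exp
  var    : Reg → Exp
  read   : Arr → Exp → Exp
  succ   : Exp → Exp
  _⊖_    : Exp → Exp → Exp

eval : Exp → State → ℕ
eval (lit k)    σ = k
eval (var x)    σ = reg σ x
eval (read a e) σ = arr σ a (eval e σ)
eval (succ e)   σ = suc (eval e σ)
eval (e ⊖ f)    σ = eval e σ ∸ eval f σ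

cost : Exp → ℕ
cost (lit k)    = 1
cost (var x)    = 1
cost (read a e) = 1 + cost e
cost (succ e)   = 1 + cost e
cost (e ⊖ f)    = 1 + cost e + cost f

infix  20 _:=_ _[_]:=_
infix  18 If_Then_Else_ While_Do_
infixr 15 _⨾_

data Program : Set where
  skip              : Program
  _:=_              : Reg → Exp → Program
  _[_]:=_           : Arr → Exp → Exp → Program
  _⨾_               : Program → Program → Program
  If_Then_Else_     : Exp → Program → Program → Program
  While_Do_         : Exp → Program → Program

-- ⟨ p , σ ⟩⇓[ t ] τ : started in σ, the program p halts in τ after exactly
-- t steps.  A test succeeds when its value is nonzero.

data ⟨_,_⟩⇓[_]_ : Program → State → ℕ → State → Set where
  ⇓skip   : ∀ {σ} → ⟨ skip , σ ⟩⇓[ 1 ] σ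
  ⇓assign : ∀ {σ x e} →
            ⟨ x := e , σ ⟩⇓[ 1 + cost e ]
              ⟪ reg σ ⟦ x ≔ eval e σ ⟧ , arr σ ⟫
  ⇓store  : ∀ {σ a e f} →
            ⟨ a [ e ]:= f , σ ⟩⇓[ 1 + cost e + cost f ]
              ⟪ reg σ , arr σ ⟦ a ≔ arr σ a ⟦ eval e σ ≔ eval f σ ⟧ ⟧ ⟫
  ⇓seq    : ∀ {σ τ υ p q s t} →
            ⟨ p , σ ⟩⇓[ s ] τ → ⟨ q , τ ⟩⇓[ t ] υ →
            ⟨ p ⨾ q , σ ⟩⇓[ s + t ] υ
  ⇓then   : ∀ {σ τ e p q t} → eval e σ ≢ 0 →
            ⟨ p , σ ⟩⇓[ t ] τ →
            ⟨ If e Then p Else q , σ ⟩⇓[ 1 + cost e + t ] τ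
  ⇓else   : ∀ {σ τ e p q t} → eval e σ ≡ 0 →
            ⟨ q , σ ⟩⇓[ t ] τ →
            ⟨ If e Then p Else q , σ ⟩⇓[ 1 + cost e + t ] τ
  ⇓loop   : ∀ {σ τ υ e p s t} → eval e σ ≢ 0 →
            ⟨ p , σ ⟩⇓[ s ] τ → ⟨ While e Do p , τ ⟩⇓[ t ] υ →
            ⟨ While e Do p , σ ⟩⇓[ 1 + cost e + s + t ] υ
  ⇓done   : ∀ {σ e p} → eval e σ ≡ 0 →
            ⟨ While e Do p , σ ⟩⇓[ 1 + cost e ] σ

------------------------------------------------------------------------
-- Input and output conventions.

-- The premise A of a rule is presented to the machine as a list of its
-- elements, in arbitrary order and without repetition.

Listing : ℕ → Set
Listing n = List (List (Fin n) × Fin n)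

Lists : ∀ {n} → List (Fin n) × Fin n → Rule n → Set
Lists (as , p) (A , q) =
  Unique as × (∀ a → (a List.∈ as) ⇔ (a ∈ A)) × p ≡ q

Presents : ∀ {n} → Listing n → List (Rule n) → Set
Presents = Pointwise Lists

bit : Bool → ℕ
bit false = 0
bit true  = 1

-- The input consists of 2 + n + inputSize R + (number of rules) words, hence
-- of at most 2 + 3 * inputSize R words when n ≤ inputSize R.

encode : ∀ {n} → Listing n → Subset n → List ℕ
encode {n} L X =
  n ∷ map bit (toList X) ++ length L ∷ concatMap encodeRule L
  where
  encodeRule : List (Fin n) × Fin n → List ℕ
  encodeRule (as , q) = toℕ q ∷ length as ∷ map toℕ as

wordAt : List ℕ → ℕ → ℕ
wordAt []       _       = 0
wordAt (w ∷ ws) zero    = w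
wordAt (w ∷ ws) (suc i) = wordAt ws i

inputArr outputArr : Arr
inputArr  = 0
outputArr = 1

initial : List ℕ → State
initial ws = ⟪ (λ _ → 0) , (λ _ _ → 0) ⟦ inputArr ≔ wordAt ws ⟧ ⟫

-- The output is a subset given by its characteristic vector.

Outputs : ∀ {n} → State → Subset n → Set
Outputs {n} τ Z = ∀ (i : Fin n) → arr τ outputArr (toℕ i) ≡ bit (lookup Z i)

{-# OPTIONS --safe #-}

-- X° is the greedy closure of ∅ inside X: an element x of X can be added to Y
-- as soon as every rule (A , x) has a premise in Y ∪ {x}.  If nothing can be
-- added to Y, then each x in X ∖ Y has a rule (A , x) with A disjoint from
-- Y ∪ {x}, and this rule keeps every accessible chain inside X from leaving Y.
--
-- The machine keeps for each element x the number of unsatisfied rules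
-- concluding x, plus 1 if x lies outside X, and puts x on a stack when this
-- number drops to 0.  Popping x walks through the linked list of the
-- occurrences of x in premises and satisfies their rules.  Give x the weight
-- 1 + (number of occurrences of x): each step of this loop decreases the total
-- weight of the elements that are not yet popped plus the length of the part of
-- the current list still to be walked, a quantity that is at first at most
-- n + inputSize R.

module Submission where

open import Defs
open import Algebra.Properties.CommutativeSemigroup using (interchange)
open import Data.Bool using (true; false; T)
open import Data.Fin as Fin using (Fin; toℕ; fromℕ; fromℕ<; inject₁)
open import Data.Fin.Induction using (<-weakInduction)
open import Data.Fin.Properties using (toℕ-inject₁; toℕ-fromℕ; toℕ-fromℕ<; toℕ<n; toℕ≤pred[n]; toℕ-injective)
open import Data.Fin.Subset as Subset using (Subset; inside; outside; _∈_; _∉_; _⊆_; _∩_; _─_; _-_; ∣_∣; Nonempty)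
open import Data.Fin.Subset.Properties using (∉⊥; _∈?_; x∈p∩q⁺; x∈p∩q⁻; x∈p∧x∉q⇒x∈p─q; x∈p∧x≢y⇒x∈p-y; x∈p⇒∣p-x∣<∣p∣)
open import Data.List using (List; _∷_; []; _++_; map; concatMap; length)
import Data.List.Membership.Propositional as List
open import Data.List.Relation.Binary.Pointwise using ([]; _∷_)
open import Data.List.Relation.Unary.All as All using ()
open import Data.List.Relation.Unary.Any using (here; there)
open import Data.List.Relation.Unary.Unique.Propositional using (Unique; []; _∷_)
open import Data.Nat
open import Data.Nat.Properties
open import Data.Nat.Tactic.RingSolver using (solve-∀)
open import Data.Product using (_×_; _,_; Σ-syntax; proj₁; proj₂; map₂)
open import Data.Sum as Sum using (_⊎_; inj₁; inj₂)
open import Data.Vec using (_∷_; []; _[_]≔_; here; there; lookup; toList)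
open import Data.Vec.Properties using ([]≔-updates; []≔-minimal; []=⇒lookup; lookup⇒[]=; lookup∘updateAt′; lookup-replicate)
open import Function using (_∘_; Equivalence)
open import Relation.Binary.PropositionalEquality
open import Relation.Nullary using (yes; no; contradiction)

-- Sums and point updates

-- Case analysis for updated functions under any predicate. `does (i ≟ k)` computes to `i ≡ᵇ k`, so
-- abstracting that boolean unfolds the update.
≔-elim : ∀ {A : Set} (P : A → Set) (f : ℕ → A) {k v} i →
  (i ≡ k → P v) → (i ≢ k → P (f i)) → P ((f ⟦ k ≔ v ⟧) i)
≔-elim P f {k} i eq neq with i ≡ᵇ k in test
... | true  = eq (≡ᵇ⇒≡ i k (subst T (sym test) _))
... | false = neq (λ i≡k → subst T test (≡⇒≡ᵇ i k i≡k))

≔-same : ∀ {A : Set} (f : ℕ → A) {v} k → (f ⟦ k ≔ v ⟧) k ≡ v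
≔-same f k = ≔-elim (_≡ _) f k (λ _ → refl) (λ k≢k → contradiction refl k≢k)

≔-other : ∀ {A : Set} (f : ℕ → A) {k v i} → i ≢ k → (f ⟦ k ≔ v ⟧) i ≡ f i
≔-other f {i = i} i≢k = ≔-elim (_≡ f i) f i (λ i≡k → contradiction i≡k i≢k) (λ _ → refl)

≔-mark : ∀ (f : ℕ → ℕ) {k} i → f i ≢ 0 → (f ⟦ k ≔ 1 ⟧) i ≢ 0
≔-mark f i fi≢0 = ≔-elim (_≢ 0) f i (λ _ ()) (λ _ → fi≢0)

1∸m≡0 : ∀ {m} → m ≢ 0 → 1 ∸ m ≡ 0
1∸m≡0 {zero}  m≢0 = contradiction refl m≢0
1∸m≡0 {suc m} _   = 0∸n≡0 m

∑ : ℕ → (ℕ → ℕ) → ℕ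
∑ zero    f = 0
∑ (suc k) f = f k + ∑ k f

∑-cong : ∀ k {f g : ℕ → ℕ} → (∀ i → i < k → f i ≡ g i) → ∑ k f ≡ ∑ k g
∑-cong zero    eq = refl
∑-cong (suc k) eq = cong₂ _+_ (eq k ≤-refl) (∑-cong k (λ i i<k → eq i (m<n⇒m<1+n i<k)))

∑-zero : ∀ k {f} → (∀ i → i < k → f i ≡ 0) → ∑ k f ≡ 0
∑-zero zero    eq = refl
∑-zero (suc k) eq rewrite eq k ≤-refl = ∑-zero k (λ i i<k → eq i (m<n⇒m<1+n i<k))

∑-term : ∀ k {f i} → i < k → f i ≤ ∑ k f
∑-term (suc k) {f} {i} i<sk with i ≟ k
... | yes refl = m≤m+n _ _
... | no  i≢k  = ≤-trans (∑-term k (≤∧≢⇒< (≤-pred i<sk) i≢k)) (m≤n+m _ _)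

∑-nonzero : ∀ k {f} → ∑ k f ≢ 0 → Σ[ i ∈ ℕ ] (i < k × f i ≢ 0)
∑-nonzero zero    ne = contradiction refl ne
∑-nonzero (suc k) {f} ne with f k ≟ 0
... | no  fk≢0 = k , ≤-refl , fk≢0
... | yes fk≡0 with i , i<k , fi≢0 ← ∑-nonzero k (ne ∘ cong₂ _+_ fk≡0) =
  i , m<n⇒m<1+n i<k , fi≢0

∑-monoˡ : ∀ {j k} f → j ≤ k → ∑ j f ≤ ∑ k f
∑-monoˡ f z≤n = z≤n
∑-monoˡ {suc j} {suc k} f j≤k with m≤n⇒m<n∨m≡n j≤k
... | inj₂ refl = ≤-refl
... | inj₁ j<k  = ≤-trans (∑-monoˡ {suc j} {k} f (≤-pred j<k)) (m≤n+m _ _)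

∑-+ : ∀ k f g → ∑ k (λ i → f i + g i) ≡ ∑ k f + ∑ k g
∑-+ zero    f g = refl
∑-+ (suc k) f g rewrite ∑-+ k f g =
  interchange +-commutativeSemigroup (f k) (g k) (∑ k f) (∑ k g)

∑-suc : ∀ k f → ∑ k (suc ∘ f) ≡ k + ∑ k f
∑-suc zero    f = refl
∑-suc (suc k) f rewrite ∑-suc k f = cong suc (begin
  f k + (k + ∑ k f) ≡⟨ +-assoc (f k) k _ ⟨
  f k + k + ∑ k f   ≡⟨ cong (_+ ∑ k f) (+-comm (f k) k) ⟩
  k + f k + ∑ k f   ≡⟨ +-assoc k (f k) _ ⟩
  k + (f k + ∑ k f) ∎)
  where open ≡-Reasoning

-- Both sides are moved so that no subtraction occurs.
∑-point : ∀ k {f g r} → r < k → (∀ i → i ≢ r → f i ≡ g i) →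
  ∑ k f + g r ≡ ∑ k g + f r
∑-point (suc k) {f} {g} {r} r<sk eq with r ≟ k
... | yes refl rewrite ∑-cong k (λ i i<k → eq i (<⇒≢ i<k)) =
  swap (f r) (∑ r g) (g r)
  where
  swap : ∀ a b c → a + b + c ≡ c + b + a
  swap = solve-∀
... | no r≢k rewrite eq k (r≢k ∘ sym) = begin
  g k + ∑ k f + g r   ≡⟨ +-assoc (g k) _ _ ⟩
  g k + (∑ k f + g r) ≡⟨ cong (g k +_) (∑-point k (≤∧≢⇒< (≤-pred r<sk) r≢k) eq) ⟩
  g k + (∑ k g + f r) ≡⟨ +-assoc (g k) _ _ ⟨
  g k + ∑ k g + f r   ∎
  where open ≡-Reasoning

-- Counting occurrences

δ : ℕ → ℕ → ℕ
δ y = (λ _ → 0) ⟦ y ≔ 1 ⟧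

δ-refl : ∀ x → δ x x ≡ 1
δ-refl = ≔-same _

∑-δ : ∀ n y → ∑ n (δ y) ≤ 1
∑-δ zero    y = z≤n
∑-δ (suc n) y with n ≟ y
... | no n≢y rewrite ≔-other (λ _ → 0) {v = 1} n≢y = ∑-δ n y
... | yes refl
  rewrite ∑-zero n {δ n} (λ i i<n → ≔-other _ (<⇒≢ i<n)) = ≤-reflexive (cong (_+ 0) (δ-refl n))

occurrences : (ℕ → ℕ) → ℕ → ℕ → ℕ
occurrences f M x = ∑ M (λ k → δ (f k) x)

-- Double counting: each index `k < M` is counted for at most one value `x < n`, namely `f k`.
∑-occurrences : ∀ n f M → ∑ n (occurrences f M) ≤ M
∑-occurrences n f zero    = ≤-reflexive (∑-zero n (λ _ _ → refl))
∑-occurrences n f (suc M) rewrite ∑-+ n (δ (f M)) (occurrences f M) =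
  +-mono-≤ (∑-δ n (f M)) (∑-occurrences n f M)

-- Timed total correctness

Runs : ℕ → Program → State → (State → Set) → Set
Runs T p σ Q = Σ[ t ∈ ℕ ] Σ[ τ ∈ State ] (⟨ p , σ ⟩⇓[ t ] τ × t ≤ T × Q τ)

runs-seq : ∀ {T U p q σ P Q} → Runs T p σ P → (∀ τ → P τ → Runs U q τ Q) →
  Runs (T + U) (p ⨾ q) σ Q
runs-seq (_ , τ , p⇓ , t≤T , Pτ) after with _ , υ , q⇓ , u≤U , Qυ ← after τ Pτ =
  _ , υ , ⇓seq p⇓ q⇓ , +-mono-≤ t≤T u≤U , Qυ

-- B is a variant: it bounds the number of iterations still to come.
runs-while : ∀ {T e p} (Inv : ℕ → State → Set) →
  (∀ B σ → Inv B σ → eval e σ ≢ 0 → Runs T p σ (λ τ → Σ[ B′ ∈ ℕ ] (B′ < B × Inv B′ τ))) →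
  ∀ {A} B σ → B ≤ A → Inv B σ →
  Runs ((1 + cost e + T) * suc A) (While e Do p) σ (λ τ → Σ[ B′ ∈ ℕ ] (Inv B′ τ × eval e τ ≡ 0))
runs-while {T} {e} Inv body {A} B σ B≤A inv with eval e σ ≟ 0
... | yes stop = _ , σ , ⇓done stop , ≤-trans (m≤m+n _ T) (m≤m*n _ (suc A)) , B , inv , stop
... | no  go with body B σ inv go
...   | s , τ , p⇓ , s≤T , B′ , B′<B , invτ with A
...     | zero   = contradiction (<-≤-trans B′<B B≤A) λ ()
...     | suc A′ with runs-while Inv body B′ τ (≤-pred (<-≤-trans B′<B B≤A)) invτ
...       | t , υ , rest⇓ , t≤ , post =
  _ , υ , ⇓loop go p⇓ rest⇓ ,
  ≤-trans (+-mono-≤ (+-monoʳ-≤ (1 + cost e) s≤T) t≤) (≤-reflexive (sym (*-suc _ (suc A′)))) ,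
  post

-- Accessible sets

private variable
  n : ℕ

infixl 6 _⊕_
_⊕_ : Subset n → Fin n → Subset n
Y ⊕ x = Y [ x ]≔ inside

x∈Y⊕x : ∀ (Y : Subset n) x → x ∈ Y ⊕ x
x∈Y⊕x Y x = []≔-updates Y x

Y⊆Y⊕x : ∀ (Y : Subset n) x → Y ⊆ Y ⊕ x
Y⊆Y⊕x Y x {y} y∈Y with y Fin.≟ x
... | yes refl = x∈Y⊕x Y x
... | no  y≢x  = []≔-minimal Y y x y≢x y∈Y

∈⊕⇒∈ : ∀ (Y : Subset n) {x y} → y ∈ Y ⊕ x → y ≢ x → y ∈ Y
∈⊕⇒∈ (_ ∷ Y) {Fin.zero}  here      y≢x = contradiction refl y≢x
∈⊕⇒∈ (_ ∷ Y) {Fin.zero}  (there p) y≢x = there p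
∈⊕⇒∈ (_ ∷ Y) {Fin.suc x} here      y≢x = here
∈⊕⇒∈ (_ ∷ Y) {Fin.suc x} (there p) y≢x = there (∈⊕⇒∈ Y p (y≢x ∘ cong Fin.suc))

∣Y─Y∣≡0 : ∀ (Y : Subset n) → ∣ Y ─ Y ∣ ≡ 0
∣Y─Y∣≡0 []            = refl
∣Y─Y∣≡0 (inside  ∷ Y) = ∣Y─Y∣≡0 Y
∣Y─Y∣≡0 (outside ∷ Y) = ∣Y─Y∣≡0 Y

∣Y⊕x─Y∣≡1 : ∀ (Y : Subset n) {x} → x ∉ Y → ∣ (Y ⊕ x) ─ Y ∣ ≡ 1
∣Y⊕x─Y∣≡1 (inside  ∷ Y) {Fin.zero}  x∉Y = contradiction here x∉Y
∣Y⊕x─Y∣≡1 (outside ∷ Y) {Fin.zero}  x∉Y = cong suc (∣Y─Y∣≡0 Y)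
∣Y⊕x─Y∣≡1 (inside  ∷ Y) {Fin.suc x} x∉Y = ∣Y⊕x─Y∣≡1 Y (x∉Y ∘ there)
∣Y⊕x─Y∣≡1 (outside ∷ Y) {Fin.suc x} x∉Y = ∣Y⊕x─Y∣≡1 Y (x∉Y ∘ there)

-- Two distinct members could be removed one after the other, each removal lowering a cardinality
-- that starts at 1.
∣p∣≡1⇒unique : ∀ (p : Subset n) {x y} → ∣ p ∣ ≡ 1 → x ∈ p → y ∈ p → x ≡ y
∣p∣≡1⇒unique p {x} {y} ∣p∣≡1 x∈p y∈p with x Fin.≟ y
... | yes x≡y = x≡y
... | no  x≢y = contradiction
  (<-≤-trans (x∈p⇒∣p-x∣<∣p∣ (x∈p∧x≢y⇒x∈p-y x∈p x≢y))
             (≤-pred (<-≤-trans (x∈p⇒∣p-x∣<∣p∣ y∈p) (≤-reflexive ∣p∣≡1))))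
  λ ()

-- Acceptance itself is not monotone, as a larger set may gain the conclusion; but a premise met
-- inside `Y` is still met inside `Y′`.
Accepts-mono : ∀ {r : Rule n} {Y Y′} → Y ⊆ Y′ → Accepts r Y → proj₂ r ∈ Y → Nonempty (Y′ ∩ proj₁ r)
Accepts-mono {r = A , q} {Y} Y⊆Y′ acc q∈Y with a , a∈ ← acc q∈Y
  with a∈Y , a∈A ← x∈p∩q⁻ Y A a∈ = a , x∈p∩q⁺ (Y⊆Y′ a∈Y , a∈A)

-- The chains of `𝒜` built one element at a time, which is how the machine produces them.
data Reach (R : List (Rule n)) : Subset n → Set where
  start  : Reach R Subset.⊥
  extend : ∀ {Y x} → Reach R Y → x ∉ Y → 𝒦 R (Y ⊕ x) → Reach R (Y ⊕ x)

Reach⇒𝒦 : ∀ {R : List (Rule n)} {Y} → Reach R Y → 𝒦 R Y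
Reach⇒𝒦 start              = All.tabulate λ _ q∈⊥ → contradiction q∈⊥ ∉⊥
Reach⇒𝒦 (extend _ _ accepted) = accepted

-- Stages are indexed by all of `ℕ`, with arbitrary values beyond `len`, so that lengthening a chain
-- is a point update.
record Chain (R : List (Rule n)) (K : Subset n) : Set where
  field
    len   : ℕ
    stage : ℕ → Subset n
    first : stage 0 ≡ Subset.⊥
    final : stage len ≡ K
    valid : ∀ i → i ≤ len → 𝒦 R (stage i)
    steps : ∀ i → i < len → stage i ⊆ stage (suc i) × ∣ stage (suc i) ─ stage i ∣ ≡ 1

Reach⇒Chain : ∀ {R : List (Rule n)} {K} → Reach R K → Chain R K
Reach⇒Chain start = record
  { len = 0 ; stage = λ _ → Subset.⊥ ; first = refl ; final = refl
  ; valid = λ _ _ → Reach⇒𝒦 start ; steps = λ _ () }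
Reach⇒Chain {R = R} (extend {Y} {x} reach x∉Y accepted) = record
  { len = suc len ; stage = stage′ ; first = first ; final = new
  ; valid = λ i i≤ → ≔-elim (𝒦 R) stage i (λ _ → accepted) (valid i ∘ old i i≤)
  ; steps = step }
  where
  open Chain (Reach⇒Chain reach)
  stage′ = stage ⟦ suc len ≔ Y ⊕ x ⟧
  new : stage′ (suc len) ≡ Y ⊕ x
  new = ≔-same stage (suc len)
  old : ∀ i → i ≤ suc len → i ≢ suc len → i ≤ len
  old i i≤ i≢ = ≤-pred (≤∧≢⇒< i≤ i≢)
  step : ∀ i → i < suc len → stage′ i ⊆ stage′ (suc i) × ∣ stage′ (suc i) ─ stage′ i ∣ ≡ 1
  step i i<sl with i ≟ len
  ... | yes refl
    rewrite ≔-same stage {Y ⊕ x} (suc len) | ≔-other stage {v = Y ⊕ x} (<⇒≢ i<sl) | final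
    = Y⊆Y⊕x Y x , ∣Y⊕x─Y∣≡1 Y x∉Y
  ... | no i≢l
    rewrite ≔-other stage {v = Y ⊕ x} (i≢l ∘ suc-injective) | ≔-other stage {v = Y ⊕ x} (<⇒≢ i<sl)
    = steps i (≤∧≢⇒< (≤-pred i<sl) i≢l)

Reach⇒𝒜 : ∀ {R : List (Rule n)} {K} → Reach R K → 𝒜 R K
Reach⇒𝒜 reach =
  Reach⇒𝒦 reach , len , stage ∘ toℕ , first ,
  trans (cong stage (toℕ-fromℕ len)) final ,
  (λ i → valid (toℕ i) (toℕ≤pred[n] i)) ,
  (λ i → subst (λ j → stage j ⊆ stage (suc (toℕ i)) × ∣ stage (suc (toℕ i)) ─ stage j ∣ ≡ 1)
               (sym (toℕ-inject₁ i)) (steps (toℕ i) (toℕ<n i)))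
  where open Chain (Reach⇒Chain reach)

-- An obstruction to adding `x`: its rule rejects every set that contains `x` and is contained in
-- `Z` together with `x`.
Blocked : List (Rule n) → Subset n → Fin n → Set
Blocked R Z x = Σ[ A ∈ Subset _ ] ((A , x) List.∈ R × (∀ {a} → a ∈ A → a ∉ Z × a ≢ x))

-- Induction along a chain of `W`. If a step left `Z` at `y`, the rule blocking `y` would need a
-- premise outside `Z` and different from `y`, and the step would add two elements.
Reach⇒IsMaximumIn : ∀ {R : List (Rule n)} {X Z} → Reach R Z → Z ⊆ X →
  (∀ {x} → x ∈ X → x ∉ Z → Blocked R Z x) → IsMaximumIn R X Z
Reach⇒IsMaximumIn {R = R} {X} {Z} reach Z⊆X blocked = Reach⇒𝒜 reach , Z⊆X , largest
  where
  largest : ∀ W → 𝒜 R W → W ⊆ X → W ⊆ Z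
  largest W (_ , k , Y , Y₀≡⊥ , Yₖ≡W , valid , steps) W⊆X w∈W =
    below (fromℕ k) (subst (_ ⊆_) Yₖ≡W λ y → y) (subst (_ ∈_) (sym Yₖ≡W) w∈W)
    where
    step : ∀ i → (Y (inject₁ i) ⊆ W → Y (inject₁ i) ⊆ Z) → Y (Fin.suc i) ⊆ W → Y (Fin.suc i) ⊆ Z
    step i ih Y⊆W {y} y∈Y with y ∈? Z
    ... | yes y∈Z = y∈Z
    ... | no  y∉Z
      with A , r∈R , avoid ← blocked (W⊆X (Y⊆W y∈Y)) y∉Z
      with a , a∈Y∩A ← All.lookup (valid (Fin.suc i)) r∈R y∈Y
      with a∈Y , a∈A ← x∈p∩q⁻ (Y (Fin.suc i)) A a∈Y∩A
      with a∉Z , a≢y ← avoid a∈A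
      -- Both `a` and `y` lie in the new stage but not in the old one, which is contained in `Z`.
      = contradiction
          (∣p∣≡1⇒unique _ (proj₂ (steps i)) (x∈p∧x∉q⇒x∈p─q a∈Y (a∉Z ∘ old)) (x∈p∧x∉q⇒x∈p─q y∈Y (y∉Z ∘ old)))
          a≢y
      where
      old : Y (inject₁ i) ⊆ Z
      old = ih (Y⊆W ∘ proj₁ (steps i))
    below : ∀ i → Y i ⊆ W → Y i ⊆ Z
    -- Inclusion in `W` is kept as a hypothesis: it passes from each stage down to the previous one.
    below = <-weakInduction (λ i → Y i ⊆ W → Y i ⊆ Z)
      (λ _ y∈Y₀ → contradiction (subst (_ ∈_) Y₀≡⊥ y∈Y₀) ∉⊥) step

-- Invariants of the algorithm

-- The k-th pair of a rule and an element of its premise is the element elem k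
-- of rule owner k; rule j concludes concl j.
record Tables : Set where
  constructor mkTables
  field
    occs rules       : ℕ
    elem owner concl : ℕ → ℕ

Occ : ∀ {n} → ℕ → (elem owner : ℕ → ℕ) → ℕ → Fin n → Set
Occ occs elem owner j a = Σ[ k ∈ ℕ ] (k < occs × owner k ≡ j × elem k ≡ toℕ a)

-- 1 if rule j concludes x and sat does not mark it yet, and 0 otherwise.
due : (concl sat : ℕ → ℕ) → ℕ → ℕ → ℕ
due concl sat x j = δ (concl j) x ∸ sat j

due≢0 : ∀ concl sat x j → due concl sat x j ≢ 0 → concl j ≡ x × sat j ≡ 0
due≢0 concl sat x j = ≔-elim (λ d → d ∸ sat j ≢ 0 → concl j ≡ x × sat j ≡ 0) (λ _ → 0) x
  (λ x≡ ne → sym x≡ , 1∸s≢0 (sat j) ne)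
  (λ _ ne → contradiction (0∸n≡0 (sat j)) ne)
  where
  1∸s≢0 : ∀ s → 1 ∸ s ≢ 0 → s ≡ 0
  1∸s≢0 zero    _  = refl
  1∸s≢0 (suc s) ne = contradiction (0∸n≡0 s) ne

-- h is one more than the last index below b at which f takes the value x,
-- or 0 if there is none.
record Last (f : ℕ → ℕ) (b x h : ℕ) : Set where
  field
    bound : h ≤ b
    later : ∀ k → k < b → f k ≡ x → k < h
    value : ∀ k → h ≡ suc k → f k ≡ x

-- ban acts as a rule (∅ , x) for each x outside X, which confines the closure to X.
module Invariants {n} (R : List (Rule n)) (X : Subset n) (ban : ℕ → ℕ)
  (ban-X : ∀ i → ban (toℕ i) ≡ 1 ∸ bit (lookup X i)) where

  -- `index-of` serves to show that the sets built accept every rule; `rule-of` turns an unmarked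
  -- row into a blocking rule.
  record Faithful (𝕋 : Tables) : Set where
    open Tables 𝕋
    Represents : ℕ → Rule n → Set
    Represents j (A , q) = concl j ≡ toℕ q
      × (∀ {a} → a ∈ A → Occ occs elem owner j a)
      × (∀ {a} → Occ occs elem owner j a → a ∈ A)
    field
      rule-of  : ∀ {j} → j < rules → Σ[ r ∈ Rule n ] (r List.∈ R × Represents j r)
      index-of : ∀ {r} → r List.∈ R → Σ[ j ∈ ℕ ] (j < rules × Represents j r)
      owner<   : ∀ {k} → k < occs → owner k < rules
      elem<    : ∀ {k} → k < occs → elem k < n

    concl< : ∀ {j} → j < rules → concl j < n
    concl< j<m with (_ , q) , _ , c≡q , _ ← rule-of j<m = subst (_< n) (sym c≡q) (toℕ<n q)

  Counts : (rules : ℕ) (concl sat cnt : ℕ → ℕ) → Set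
  Counts m concl sat cnt = ∀ x → x < n → cnt x ≡ ban x + ∑ m (due concl sat x)

  Reached : (ℕ → ℕ) → Set
  Reached out = Σ[ Y ∈ Subset n ] (Reach R Y × Y ⊆ X × (∀ i → out (toℕ i) ≡ bit (lookup Y i)))

  -- Linked lists in arrays: `first x` heads the list of the occurrences of `x`, in decreasing
  -- order, and `next` continues it. Pointers are shifted by one so that 0 is the null pointer.
  Linked : (bound : ℕ) (elem first next : ℕ → ℕ) → Set
  Linked b elem first next =
    (∀ x → Last elem b x (first x)) × (∀ k → k < b → Last elem k (elem k) (next k))

  -- Insertion at the head: the old head was the last occurrence of `elem b` before `b`, which is
  -- what `next b` has to be.
  link : ∀ {b elem first next} → Linked b elem first next →
    Linked (suc b) elem (first ⟦ elem b ≔ suc b ⟧) (next ⟦ b ≔ first (elem b) ⟧)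
  link {b} {elem} {first} {next} (firsts , nexts) = firsts′ , nexts′
    where
    open Last
    firsts′ : ∀ x → Last elem (suc b) x ((first ⟦ elem b ≔ suc b ⟧) x)
    firsts′ x = ≔-elim (Last elem (suc b) x) first x
      (λ { refl → record { bound = ≤-refl ; later = λ _ k<b _ → k<b ; value = λ { _ refl → refl } } })
      (λ x≢ → record
        { bound = m≤n⇒m≤1+n (bound (firsts x))
        ; later = λ k k<sb eq → later (firsts x) k
            (≤∧≢⇒< (≤-pred k<sb) (λ { refl → x≢ (sym eq) })) eq
        ; value = value (firsts x) })
    nexts′ : ∀ k → k < suc b → Last elem k (elem k) ((next ⟦ b ≔ first (elem b) ⟧) k)
    nexts′ k k<sb = ≔-elim (Last elem k (elem k)) next k
      (λ { refl → firsts (elem b) })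
      (λ k≢b → nexts k (≤∧≢⇒< (≤-pred k<sb) k≢b))

  module _ (𝕋 : Tables) where
    open Tables 𝕋

    -- `hits` is the soundness of the marks. Its second alternative covers a premise that equals the
    -- conclusion and so arrives together with it.
    record RuleState (sat cnt out : ℕ → ℕ) : Set where
      field
        counts : Counts rules concl sat cnt
        hits   : ∀ j → j < rules → sat j ≢ 0 →
          Σ[ k ∈ ℕ ] (k < occs × owner k ≡ j × (out (elem k) ≢ 0 ⊎ elem k ≡ concl j))

    load : ℕ → ℕ
    load x = suc (occurrences elem occs x)

    -- `out` is set when an element is pushed, so the elements not yet popped are those with `out` 0
    -- and those on the stack.
    potential : (out stack : ℕ → ℕ) → ℕ → ℕ
    potential out stack top = ∑ n (λ x → (1 ∸ out x) * load x) + ∑ top (load ∘ stack)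

    record Work (out stack : ℕ → ℕ) (top : ℕ) : Set where
      field
        reached : Reached out
        stacked : ∀ i → i < top → out (stack i) ≢ 0
        bounded : potential out stack top ≤ n + occs

    -- A rule with its conclusion in its premise is satisfied by the very step that
    -- adds the conclusion, so it must be marked before any element is pushed.
    Selfs : ℕ → (ℕ → ℕ) → Set
    Selfs b sat = ∀ k → k < b → elem k ≡ concl (owner k) → sat (owner k) ≢ 0

    -- The occurrences of cur below ptr are still to be visited.
    record Loop (sat cnt out stack : ℕ → ℕ) (top ptr cur : ℕ) : Set where
      field
        ruleState : RuleState sat cnt out
        selfs     : Selfs occs sat
        outs      : ∀ x → x < n → out x ≡ 1 ∸ cnt x
        work      : Work out stack top
        -- Completeness of the marks: a rule with a premise in the output is marked, unless that
        -- occurrence still awaits its visit, via the stack or the current list.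
        pending   : ∀ k → k < occs → out (elem k) ≢ 0 → sat (owner k) ≢ 0
                    ⊎ (Σ[ i ∈ ℕ ] (i < top × stack i ≡ elem k))
                    ⊎ (elem k ≡ cur × k < ptr)
        ptr≤      : ptr ≤ occs
        ptr-elem  : ∀ k → ptr ≡ suc k → elem k ≡ cur
        ptr-out   : ptr ≢ 0 → out cur ≢ 0

    measure : (out stack : ℕ → ℕ) (top ptr cur : ℕ) → ℕ
    measure out stack top ptr cur =
      potential out stack top + ∑ ptr (λ k → δ (elem k) cur)

  -- Preservation of the invariants

  module _ {𝕋 : Tables} (faithful : Faithful 𝕋) where
    open Tables 𝕋
    open Faithful faithful
    open RuleState
    open Work
    open Loop

    -- The mark turns exactly one summand of the count of `concl j` from 1 to 0, so the truncated
    -- subtraction is exact.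
    hit : ∀ {sat cnt out j} → j < rules → sat j ≡ 0 →
      Σ[ k ∈ ℕ ] (k < occs × owner k ≡ j × (out (elem k) ≢ 0 ⊎ elem k ≡ concl j)) →
      RuleState 𝕋 sat cnt out →
      RuleState 𝕋 (sat ⟦ j ≔ 1 ⟧) (cnt ⟦ concl j ≔ cnt (concl j) ∸ 1 ⟧) out
    hit {sat} {cnt} {out} {j} j<m satj≡0 witness st = record
      { counts = counts′
      ; hits = λ i i<m → ≔-elim (λ s → s ≢ 0 → _) sat i (λ { refl _ → witness }) (λ _ → hits st i i<m) }
      where
      sat′ = sat ⟦ j ≔ 1 ⟧
      counts′ : Counts rules concl sat′ (cnt ⟦ concl j ≔ cnt (concl j) ∸ 1 ⟧)
      counts′ x x<n = ≔-elim (_≡ ban x + ∑ rules (due concl sat′ x)) cnt x (λ { refl → hit-count x<n }) λ x≢ →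
        -- For `x` other than `concl j`, row `j` contributes 0 before and after the mark.
        trans (counts st x x<n) (cong (ban x +_) (∑-cong rules λ i _ →
          ≔-elim (λ s → due concl sat x i ≡ δ (concl i) x ∸ s) sat i
            (λ { refl → trans (cong (_∸ sat i) (≔-other (λ _ → 0) x≢))
                       (trans (0∸n≡0 (sat i)) (sym (cong (_∸ 1) (≔-other (λ _ → 0) x≢)))) })
            (λ _ → refl)))
        where
        hit-count : concl j < n → cnt (concl j) ∸ 1 ≡ ban (concl j) + ∑ rules (due concl sat′ (concl j))
        hit-count c<n = begin
          cnt (concl j) ∸ 1             ≡⟨ cong (_∸ 1) (counts st (concl j) c<n) ⟩
          ban (concl j) + before ∸ 1    ≡⟨ cong (λ s → ban (concl j) + s ∸ 1) before≡ ⟩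
          ban (concl j) + suc after ∸ 1 ≡⟨ cong (_∸ 1) (+-suc (ban (concl j)) after) ⟩
          ban (concl j) + after         ∎
          where
          open ≡-Reasoning
          before = ∑ rules (due concl sat  (concl j))
          after  = ∑ rules (due concl sat′ (concl j))
          due-before : due concl sat (concl j) j ≡ 1
          due-before rewrite satj≡0 = δ-refl (concl j)
          due-after : due concl sat′ (concl j) j ≡ 0
          due-after = trans (cong₂ _∸_ (δ-refl (concl j)) (≔-same sat j)) refl
          before≡ : before ≡ suc after
          before≡ = begin
            before                                 ≡⟨ +-identityʳ before ⟨
            before + 0                             ≡⟨ cong (before +_) due-after ⟨
            before + due concl sat′ (concl j) j    ≡⟨ ∑-point rules j<m (λ i i≢j → cong (δ (concl i) (concl j) ∸_) (sym (≔-other sat i≢j))) ⟩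
            after + due concl sat (concl j) j      ≡⟨ cong (after +_) due-before ⟩
            after + 1                              ≡⟨ +-comm after 1 ⟩
            suc after                              ∎

    -- The unmarked row contributes 1 to the count. With `outs` this shows that the conclusion has
    -- not been pushed before.
    unsatisfied⇒counted : ∀ {sat cnt out j} → RuleState 𝕋 sat cnt out → j < rules → sat j ≡ 0 →
      cnt (concl j) ≢ 0
    unsatisfied⇒counted {sat} {cnt} {out} {j} st j<m satj≡0 cnt≡0 = contradiction
      (begin
        1                                     ≡⟨ δ-refl (concl j) ⟨
        δ (concl j) (concl j) ∸ 0             ≡⟨ cong (δ (concl j) (concl j) ∸_) satj≡0 ⟨
        due concl sat (concl j) j             ≤⟨ ∑-term rules j<m ⟩
        ∑ rules (due concl sat (concl j))     ≤⟨ m≤n+m _ _ ⟩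
        ban (concl j) + ∑ rules (due concl sat (concl j)) ≡⟨ counts st (concl j) (concl< j<m) ⟨
        cnt (concl j)                         ≡⟨ cnt≡0 ⟩
        0                                     ∎) λ ()
      where open ≤-Reasoning

    bit-∈ : ∀ (Y : Subset n) i → bit (lookup Y i) ≢ 0 → i ∈ Y
    bit-∈ Y i ne with lookup Y i in eq
    ... | true  = lookup⇒[]= i Y eq
    ... | false = contradiction refl ne

    bit-∉ : ∀ (Y : Subset n) i → bit (lookup Y i) ≡ 0 → i ∉ Y
    bit-∉ Y i eq i∈Y with () ← trans (cong bit (sym ([]=⇒lookup i∈Y))) eq

    -- A zero count makes the ban vanish, so `x` lies in `X`, and leaves no unmarked rule for `x`,
    -- so each has a premise in the enlarged set. Rules with another conclusion were accepted
    -- already.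
    reached-extend : ∀ {sat cnt out x} → RuleState 𝕋 sat cnt out → x < n → out x ≡ 0 → cnt x ≡ 0 →
      Reached out → Reached (out ⟦ x ≔ 1 ⟧)
    reached-extend {sat} {cnt} {out} {x} st x<n outx≡0 cntx≡0 (Y , reach , Y⊆X , outs-Y) =
      Y ⊕ i , extend reach i∉Y (All.tabulate accepts) , Y⊕i⊆X , outs-Y′
      where
      i = fromℕ< x<n
      i≡x : toℕ i ≡ x
      i≡x = toℕ-fromℕ< x<n
      i∉Y : i ∉ Y
      i∉Y = bit-∉ Y i (trans (sym (outs-Y i)) (trans (cong out i≡x) outx≡0))
      count≡0 : ban x + ∑ rules (due concl sat x) ≡ 0
      count≡0 = trans (sym (counts st x x<n)) cntx≡0
      i∈X : i ∈ X
      i∈X = bit-∈ X i λ eq → contradiction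
        (trans (sym (trans (ban-X i) (cong (1 ∸_) eq))) (trans (cong ban i≡x) (m+n≡0⇒m≡0 (ban x) count≡0))) λ ()
      Y⊕i⊆X : Y ⊕ i ⊆ X
      Y⊕i⊆X {y} y∈ with y Fin.≟ i
      ... | yes refl = i∈X
      ... | no  y≢i  = Y⊆X (∈⊕⇒∈ Y y∈ y≢i)
      outs-Y′ : ∀ y → (out ⟦ x ≔ 1 ⟧) (toℕ y) ≡ bit (lookup (Y ⊕ i) y)
      outs-Y′ y = ≔-elim (_≡ bit (lookup (Y ⊕ i) y)) out (toℕ y)
        (λ y≡x → sym (cong bit ([]=⇒lookup (subst (_∈ Y ⊕ i) (toℕ-injective (trans i≡x (sym y≡x))) (x∈Y⊕x Y i)))))
        (λ y≢x → trans (outs-Y y) (cong bit (sym (lookup∘updateAt′ y i (λ { refl → y≢x i≡x }) Y))))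
      accepts : ∀ {r} → r List.∈ R → Accepts r (Y ⊕ i)
      accepts {A , q} r∈R q∈ with q Fin.≟ i
      ... | no q≢i = Accepts-mono (Y⊆Y⊕x Y i) (All.lookup (Reach⇒𝒦 reach) r∈R) (∈⊕⇒∈ Y q∈ q≢i)
      ... | yes refl
        with j , j<m , concl≡ , _ , mem ← index-of r∈R
        with k , k<M , refl , why ← hits st j j<m
               (λ satj≡0 → unsatisfied⇒counted st j<m satj≡0 (trans (cong cnt (trans concl≡ i≡x)) cntx≡0))
        = a , x∈p∩q⁺ (a∈Y⊕i why , mem (k , k<M , refl , sym a≡))
        where
        a = fromℕ< (elem< k<M)
        a≡ : toℕ a ≡ elem k
        a≡ = toℕ-fromℕ< (elem< k<M)
        a∈Y⊕i : out (elem k) ≢ 0 ⊎ elem k ≡ concl (owner k) → a ∈ Y ⊕ i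
        a∈Y⊕i (inj₁ ne) = Y⊆Y⊕x Y i (bit-∈ Y a (λ eq → ne (trans (cong out (sym a≡)) (trans (outs-Y a) eq))))
        -- The premise is the conclusion itself, hence the element being added.
        a∈Y⊕i (inj₂ eq) = subst (_∈ Y ⊕ i) (toℕ-injective (sym (trans a≡ (trans eq concl≡)))) (x∈Y⊕x Y i)

    -- The weight of `x` only moves from the unmarked elements to the stack, so a push costs the
    -- measure nothing.
    potential-push : ∀ out stack top {x} → x < n → out x ≡ 0 →
      potential 𝕋 (out ⟦ x ≔ 1 ⟧) (stack ⟦ top ≔ x ⟧) (suc top) ≡ potential 𝕋 out stack top
    potential-push out stack top {x} x<n outx≡0 = begin
      after + (load 𝕋 ((stack ⟦ top ≔ x ⟧) top) + ∑ top (load 𝕋 ∘ (stack ⟦ top ≔ x ⟧)))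
        ≡⟨ cong₂ (λ u v → after + (load 𝕋 u + v)) (≔-same stack top)
             (∑-cong top λ i i<top → cong (load 𝕋) (≔-other stack (<⇒≢ i<top))) ⟩
      after + (load 𝕋 x + ∑ top (load 𝕋 ∘ stack)) ≡⟨ +-assoc after _ _ ⟨
      after + load 𝕋 x + ∑ top (load 𝕋 ∘ stack)   ≡⟨ cong (_+ ∑ top (load 𝕋 ∘ stack)) before≡ ⟨
      before + ∑ top (load 𝕋 ∘ stack) ∎
      where
      open ≡-Reasoning
      fresh : (ℕ → ℕ) → ℕ → ℕ
      fresh out x = (1 ∸ out x) * load 𝕋 x
      before = ∑ n (fresh out)
      after  = ∑ n (fresh (out ⟦ x ≔ 1 ⟧))
      before≡ : before ≡ after + load 𝕋 x
      before≡ = begin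
        before                                ≡⟨ +-identityʳ before ⟨
        -- The added 0 is the summand of `x` after the push, in the shape that `∑-point` asks for.
        before + 0                            ≡⟨ cong (λ o → before + (1 ∸ o) * load 𝕋 x) (≔-same out x) ⟨
        before + fresh (out ⟦ x ≔ 1 ⟧) x      ≡⟨ ∑-point n x<n (λ i i≢x → cong (λ o → (1 ∸ o) * load 𝕋 i) (sym (≔-other out i≢x))) ⟩
        after + fresh out x                   ≡⟨ cong (λ o → after + (1 ∸ o) * load 𝕋 x) outx≡0 ⟩
        after + 1 * load 𝕋 x                  ≡⟨ cong (after +_) (*-identityˡ _) ⟩
        after + load 𝕋 x                      ∎

    work-push : ∀ {sat cnt out stack top x} → RuleState 𝕋 sat cnt out → x < n → out x ≡ 0 → cnt x ≡ 0 →
      Work 𝕋 out stack top → Work 𝕋 (out ⟦ x ≔ 1 ⟧) (stack ⟦ top ≔ x ⟧) (suc top)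
    work-push {out = out} {stack} {top} {x} st x<n outx≡0 cntx≡0 w = record
      { reached = reached-extend st x<n outx≡0 cntx≡0 (reached w)
      ; stacked = λ i i<st → ≔-elim (λ y → (out ⟦ x ≔ 1 ⟧) y ≢ 0) stack i
          (λ _ eq → 1+n≢0 (trans (sym (≔-same out x)) eq))
          (λ i≢top → ≔-mark out (stack i) (stacked w i (≤∧≢⇒< (≤-pred i<st) i≢top)))
      ; bounded = ≤-trans (≤-reflexive (potential-push out stack top x<n outx≡0)) (bounded w) }

    ruleState-push : ∀ {sat cnt out} x → RuleState 𝕋 sat cnt out → RuleState 𝕋 sat cnt (out ⟦ x ≔ 1 ⟧)
    ruleState-push {out = out} x st = record
      { counts = counts st
      ; hits = λ j j<m ne → grow (hits st j j<m ne) }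
      where
      grow : ∀ {j} → Σ[ k ∈ ℕ ] (k < occs × owner k ≡ j × (out (elem k) ≢ 0 ⊎ elem k ≡ concl j)) → _
      grow (k , k<M , o , inj₁ ne) = k , k<M , o , inj₁ (≔-mark out (elem k) ne)
      grow (k , k<M , o , inj₂ eq) = k , k<M , o , inj₂ eq

    -- The occurrences of the popped element go from pending on the stack to pending on the current
    -- list. Its load exceeds the length of that list by at least 1, so the measure drops.
    loop-pop : ∀ {first next sat cnt out stack top cur} → Linked occs elem first next →
      Loop 𝕋 sat cnt out stack (suc top) 0 cur →
      Loop 𝕋 sat cnt out stack top (first (stack top)) (stack top)
      × measure 𝕋 out stack top (first (stack top)) (stack top) < measure 𝕋 out stack (suc top) 0 cur
    loop-pop {first} {_} {sat} {cnt} {out} {stack} {top} {cur} (firsts , _) inv = record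
      { ruleState = ruleState inv ; selfs = selfs inv ; outs = outs inv
      ; work = record
          { reached = reached (work inv)
          ; stacked = λ i i<top → stacked (work inv) i (m<n⇒m<1+n i<top)
          ; bounded = ≤-trans (+-monoʳ-≤ (∑ n _) (m≤n+m _ (load 𝕋 (stack top)))) (bounded (work inv)) }
      ; pending = pending′
      ; ptr≤ = bound
      ; ptr-elem = value
      ; ptr-out = λ _ → stacked (work inv) top ≤-refl } , decrease
      where
      open Last (firsts (stack top))
      pending′ : ∀ k → k < occs → out (elem k) ≢ 0 → sat (owner k) ≢ 0
                    ⊎ (Σ[ i ∈ ℕ ] (i < top × stack i ≡ elem k))
                    ⊎ (elem k ≡ stack top × k < first (stack top))
      pending′ k k<M ne with pending inv k k<M ne
      ... | inj₁ done = inj₁ done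
      ... | inj₂ (inj₁ (i , i<st , eq)) with i ≟ top
      ...   | yes refl = inj₂ (inj₂ (sym eq , later k k<M (sym eq)))
      ...   | no i≢top = inj₂ (inj₁ (i , ≤∧≢⇒< (≤-pred i<st) i≢top , eq))
      decrease : measure 𝕋 out stack top (first (stack top)) (stack top) < measure 𝕋 out stack (suc top) 0 cur
      decrease = begin-strict
        unseen + ∑ top (load 𝕋 ∘ stack) + chain ≡⟨ +-assoc unseen _ chain ⟩
        unseen + (∑ top (load 𝕋 ∘ stack) + chain) ≡⟨ cong (unseen +_) (+-comm _ chain) ⟩
        unseen + (chain + ∑ top (load 𝕋 ∘ stack))
          <⟨ +-monoʳ-< unseen (+-monoˡ-< (∑ top (load 𝕋 ∘ stack)) (s≤s (∑-monoˡ _ bound))) ⟩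
        unseen + (load 𝕋 (stack top) + ∑ top (load 𝕋 ∘ stack)) ≡⟨ +-identityʳ _ ⟨
        measure 𝕋 out stack (suc top) 0 cur ∎
        where
        open ≤-Reasoning
        unseen = ∑ n (λ x → (1 ∸ out x) * load 𝕋 x)
        chain = ∑ (first (stack top)) (λ k → δ (elem k) (stack top))

    module _ {first next sat cnt out stack top k cur} (linked : Linked occs elem first next)
             (inv : Loop 𝕋 sat cnt out stack top (suc k) cur) where
      private
        k<M : k < occs
        k<M = ptr≤ inv
        elem-k : elem k ≡ cur
        elem-k = ptr-elem inv k refl
        j = owner k
        j<m = owner< k<M
        open Last (proj₂ linked k k<M)

        -- Occurrence `k` is discharged because its rule is now marked; any earlier occurrence of
        -- `cur` lies below `next k`, since no occurrence was skipped.
        pending-next : ∀ {sat′ : ℕ → ℕ} → (∀ i → sat i ≢ 0 → sat′ i ≢ 0) → sat′ j ≢ 0 →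
          ∀ k′ → k′ < occs → out (elem k′) ≢ 0 → sat′ (owner k′) ≢ 0
                    ⊎ (Σ[ i ∈ ℕ ] (i < top × stack i ≡ elem k′))
                    ⊎ (elem k′ ≡ cur × k′ < next k)
        pending-next mono satj k′ k′<M ne with pending inv k′ k′<M ne
        ... | inj₁ done = inj₁ (mono _ done)
        ... | inj₂ (inj₁ onStack) = inj₂ (inj₁ onStack)
        ... | inj₂ (inj₂ (eq , k′<sk)) with k′ ≟ k
        ...   | yes refl = inj₁ satj
        ...   | no k′≢k  = inj₂ (inj₂ (eq , later k′ (≤∧≢⇒< (≤-pred k′<sk) k′≢k) (trans eq (sym elem-k))))

        next≤ : next k ≤ occs
        next≤ = ≤-trans bound (<⇒≤ k<M)
        next-elem : ∀ k′ → next k ≡ suc k′ → elem k′ ≡ cur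
        next-elem k′ eq = trans (value k′ eq) elem-k
        out-cur : out cur ≢ 0
        out-cur = ptr-out inv λ ()
        visited-decrease : ∑ (next k) (λ i → δ (elem i) cur) < ∑ (suc k) (λ i → δ (elem i) cur)
        -- The term of `k` itself is 1, and `next k` is at most `k`.
        visited-decrease rewrite elem-k | δ-refl cur = s≤s (∑-monoˡ _ bound)

      loop-skip : sat (owner k) ≢ 0 → Loop 𝕋 sat cnt out stack top (next k) cur
        × measure 𝕋 out stack top (next k) cur < measure 𝕋 out stack top (suc k) cur
      loop-skip satj = record
        { ruleState = ruleState inv ; selfs = selfs inv ; outs = outs inv ; work = work inv
        ; pending = pending-next (λ _ ne → ne) satj
        ; ptr≤ = next≤ ; ptr-elem = next-elem ; ptr-out = λ _ → out-cur }
        , +-monoʳ-< (potential 𝕋 out stack top) visited-decrease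

      module _ (satj≡0 : sat (owner k) ≡ 0) where
        private
          q = concl j
          q<n = concl< j<m
          sat′ = sat ⟦ j ≔ 1 ⟧
          cnt′ = cnt ⟦ q ≔ cnt q ∸ 1 ⟧
          ruleState′ : RuleState 𝕋 sat′ cnt′ out
          ruleState′ = hit j<m satj≡0
            (k , k<M , refl , inj₁ (subst (λ x → out x ≢ 0) (sym elem-k) out-cur)) (ruleState inv)
          cntq≢0 : cnt q ≢ 0
          cntq≢0 = unsatisfied⇒counted (ruleState inv) j<m satj≡0
          outq≡0 : out q ≡ 0
          outq≡0 = trans (outs inv q q<n) (1∸m≡0 cntq≢0)
          selfs′ : Selfs 𝕋 occs sat′
          selfs′ i i<M eq = ≔-mark sat (owner i) (selfs inv i i<M eq)
          sat′j : sat′ j ≢ 0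
          sat′j eq = 1+n≢0 (trans (sym (≔-same sat j)) eq)
          others : ∀ x → x < n → x ≢ q → out x ≡ 1 ∸ cnt′ x
          others x x<n x≢q = trans (outs inv x x<n) (cong (1 ∸_) (sym (≔-other cnt x≢q)))

        loop-hit : cnt′ q ≢ 0 → Loop 𝕋 sat′ cnt′ out stack top (next k) cur
          × measure 𝕋 out stack top (next k) cur < measure 𝕋 out stack top (suc k) cur
        loop-hit more = record
          { ruleState = ruleState′ ; selfs = selfs′ ; outs = outs′ ; work = work inv
          ; pending = pending-next (≔-mark sat) sat′j
          ; ptr≤ = next≤ ; ptr-elem = next-elem ; ptr-out = λ _ → out-cur }
          , +-monoʳ-< (potential 𝕋 out stack top) visited-decrease
          where
          outs′ : ∀ x → x < n → out x ≡ 1 ∸ cnt′ x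
          outs′ x x<n with x ≟ q
          ... | no x≢q   = others x x<n x≢q
          ... | yes refl = trans outq≡0 (sym (m≤n⇒m∸n≡0 (n≢0⇒n>0 more)))

        loop-push : cnt′ q ≡ 0 →
          Loop 𝕋 sat′ cnt′ (out ⟦ q ≔ 1 ⟧) (stack ⟦ top ≔ q ⟧) (suc top) (next k) cur
          × measure 𝕋 (out ⟦ q ≔ 1 ⟧) (stack ⟦ top ≔ q ⟧) (suc top) (next k) cur
            < measure 𝕋 out stack top (suc k) cur
        loop-push cnt′q≡0 = record
          { ruleState = ruleState-push q ruleState′ ; selfs = selfs′ ; outs = outs′
          ; work = work-push ruleState′ q<n outq≡0 cnt′q≡0 (work inv)
          ; pending = pending′
          ; ptr≤ = next≤ ; ptr-elem = next-elem ; ptr-out = λ _ → ≔-mark out cur out-cur }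
          , <-≤-trans (+-monoʳ-< (potential 𝕋 (out ⟦ q ≔ 1 ⟧) (stack ⟦ top ≔ q ⟧) (suc top)) visited-decrease)
                      (≤-reflexive (cong (_+ ∑ (suc k) (λ i → δ (elem i) cur))
                        (potential-push out stack top q<n outq≡0)))
          where
          outs′ : ∀ x → x < n → (out ⟦ q ≔ 1 ⟧) x ≡ 1 ∸ cnt′ x
          outs′ x x<n with x ≟ q
          ... | no x≢q   = trans (≔-other out x≢q) (others x x<n x≢q)
          ... | yes refl = trans (≔-same out q) (sym (cong (1 ∸_) cnt′q≡0))
          pending′ : ∀ k′ → k′ < occs → (out ⟦ q ≔ 1 ⟧) (elem k′) ≢ 0 → sat′ (owner k′) ≢ 0
                    ⊎ (Σ[ i ∈ ℕ ] (i < suc top × (stack ⟦ top ≔ q ⟧) i ≡ elem k′))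
                    ⊎ (elem k′ ≡ cur × k′ < next k)
          pending′ k′ k′<M ne with elem k′ ≟ q
          -- The occurrences of `q` become relevant just now; they wait under the new top of the
          -- stack.
          ... | yes eq = inj₂ (inj₁ (top , ≤-refl , trans (≔-same stack top) (sym eq)))
          ... | no  el≢q
            with pending-next (≔-mark sat) sat′j k′ k′<M (subst (_≢ 0) (≔-other out el≢q) ne)
          ...   | inj₁ done = inj₁ done
          ...   | inj₂ (inj₂ onChain) = inj₂ (inj₂ onChain)
          ...   | inj₂ (inj₁ (i , i<top , eq)) =
            inj₂ (inj₁ (i , m<n⇒m<1+n i<top , trans (≔-other stack (<⇒≢ i<top)) eq))

    -- An element of `X` outside `Y` has a positive count that no ban explains, hence an unmarked
    -- rule. With nothing left to visit, `pending` keeps its premises out of `Y`, and `selfs` keeps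
    -- them different from the conclusion.
    loop-result : ∀ {sat cnt out stack cur} → Loop 𝕋 sat cnt out stack 0 0 cur →
      Σ[ Z ∈ Subset n ] (IsMaximumIn R X Z × (∀ i → out (toℕ i) ≡ bit (lookup Z i)))
    loop-result {sat} {cnt} {out} inv with Y , reach , Y⊆X , outs-Y ← reached (work inv) =
      Y , Reach⇒IsMaximumIn reach Y⊆X blocked , outs-Y
      where
      open ≡-Reasoning
      some-due : ∀ {x} → x ∈ X → x ∉ Y → ∑ rules (due concl sat (toℕ x)) ≢ 0
      some-due {x} x∈X x∉Y none = x∉Y (bit-∈ Y x λ bit≡0 → 1+n≢0 (begin
        1                        ≡⟨ cong (1 ∸_) cnt≡0 ⟨
        1 ∸ cnt (toℕ x)          ≡⟨ outs inv (toℕ x) (toℕ<n x) ⟨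
        out (toℕ x)              ≡⟨ outs-Y x ⟩
        bit (lookup Y x)         ≡⟨ bit≡0 ⟩
        0                        ∎))
        where
        cnt≡0 : cnt (toℕ x) ≡ 0
        cnt≡0 = trans (counts (ruleState inv) (toℕ x) (toℕ<n x))
          (cong₂ _+_ (trans (ban-X x) (cong (λ b → 1 ∸ bit b) ([]=⇒lookup x∈X))) none)
      blocked : ∀ {x} → x ∈ X → x ∉ Y → Blocked R Y x
      blocked {x} x∈X x∉Y
        with j , j<m , ne ← ∑-nonzero rules (some-due x∈X x∉Y)
        with concl≡x , satj≡0 ← due≢0 concl sat (toℕ x) j ne
        with (A , q) , r∈R , concl≡q , prem , _ ← rule-of j<m
        with refl ← toℕ-injective (trans (sym concl≡q) concl≡x)
        = A , r∈R , avoid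
        where
        avoid : ∀ {a} → a ∈ A → a ∉ Y × a ≢ q
        avoid {a} a∈A with k , k<M , refl , elem≡a ← prem a∈A = a∉Y , a≢x
          where
          a∉Y : a ∉ Y
          a∉Y a∈Y with pending inv k k<M (λ out≡0 → contradiction
                   (trans (cong bit (sym ([]=⇒lookup a∈Y))) (trans (sym (outs-Y a)) (trans (cong out (sym elem≡a)) out≡0))) 1+n≢0)
          ... | inj₁ satj≢0 = satj≢0 satj≡0
          ... | inj₂ (inj₁ (_ , () , _))
          ... | inj₂ (inj₂ (_ , ()))
          a≢x : a ≢ q
          a≢x refl = selfs inv k k<M (trans elem≡a (sym concl≡x)) satj≡0

-- Reading the input

-- Induction on the list, removing its head from `A`; absence of repetitions keeps the tail inside
-- what remains.
unique⇒length≤∣A∣ : ∀ {n} {as : List (Fin n)} (A : Subset n) → Unique as →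
  (∀ a → a List.∈ as → a ∈ A) → length as ≤ ∣ A ∣
unique⇒length≤∣A∣ A []              as⊆A = z≤n
unique⇒length≤∣A∣ {as = a ∷ as} A (a∉as ∷ unique) as⊆A = ≤-<-trans
  (unique⇒length≤∣A∣ (A - a) unique λ b b∈as →
    x∈p∧x≢y⇒x∈p-y (as⊆A b (there b∈as)) λ { refl → All.lookup a∉as b∈as refl })
  (x∈p⇒∣p-x∣<∣p∣ (as⊆A a (here refl)))

encodeRule : ∀ {n} → List (Fin n) × Fin n → List ℕ
encodeRule (as , q) = toℕ q ∷ length as ∷ map toℕ as

wordAt-bits : ∀ {n} (X : Subset n) ws i → wordAt (map bit (toList X) ++ ws) (toℕ i) ≡ bit (lookup X i)
wordAt-bits (b ∷ X) ws Fin.zero    = refl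
wordAt-bits (b ∷ X) ws (Fin.suc i) = wordAt-bits X ws i

wordAt-after : ∀ {n} (X : Subset n) ws i → wordAt (map bit (toList X) ++ ws) (n + i) ≡ wordAt ws i
wordAt-after []      ws i = refl
wordAt-after (b ∷ X) ws i = wordAt-after X ws i

-- The number of iterations the parsing loop still needs: one per unread premise and one per unread
-- rule header.
workload : ∀ {n} → List (Fin n) → Listing n → ℕ
workload as []            = length as
workload as ((bs , _) ∷ Ls) = length as + suc (workload bs Ls)

workload-bound : ∀ {n} {Ls : Listing n} {Rs} → Presents Ls Rs → workload [] Ls ≤ inputSize Rs
workload-bound [] = z≤n
workload-bound {Ls = (as , q) ∷ Ls} {(A , _) ∷ Rs} ((unique , as⇔A , _) ∷ pres) = begin
  suc (workload as Ls)         ≡⟨ cong suc (workload-split as Ls) ⟩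
  suc (length as + workload [] Ls) ≤⟨ s≤s (+-mono-≤ (unique⇒length≤∣A∣ A unique (Equivalence.to ∘ as⇔A)) (workload-bound pres)) ⟩
  suc (∣ A ∣ + inputSize Rs)   ≡⟨ cong (_+ inputSize Rs) (+-comm 1 ∣ A ∣) ⟩
  ∣ A ∣ + 1 + inputSize Rs     ∎
  where
  open ≤-Reasoning
  workload-split : ∀ as Ls → workload as Ls ≡ length as + workload [] Ls
  workload-split as []       = sym (+-identityʳ _)
  workload-split as (_ ∷ Ls) = refl

-- Building the tables from the listing

module Parsing {n} (R : List (Rule n)) (X : Subset n) (ban : ℕ → ℕ)
  (ban-X : ∀ i → ban (toℕ i) ≡ 1 ∸ bit (lookup X i)) where

  open Invariants R X ban ban-X

  -- as lists the elements of the current rule, number rules ∸ 1, and Rs the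
  -- rules that are still to be read.
  record Parsed (as : List (Fin n)) (Rs : List (Rule n)) (𝕋 : Tables) : Set where
    open Tables 𝕋
    Partial : ℕ → Rule n → Set
    Partial j (A , q) = concl j ≡ toℕ q
      × (∀ {a} → a ∈ A → Occ occs elem owner j a ⊎ (j ≡ rules ∸ 1 × a List.∈ as))
      × (∀ {a} → Occ occs elem owner j a ⊎ (j ≡ rules ∸ 1 × a List.∈ as) → a ∈ A)
    field
      owner<  : ∀ {k} → k < occs → owner k < rules
      elem<   : ∀ {k} → k < occs → elem k < n
      -- Excludes `rules` being 0 while premises are unread, where `rules ∸ 1` would name no row.
      begun   : ∀ {a} → a List.∈ as → rules ∸ 1 < rules
      partial : ∀ {j} → j < rules → Σ[ r ∈ Rule n ] (r List.∈ R × Partial j r)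
      indexed : ∀ {r} → r List.∈ R → (Σ[ j ∈ ℕ ] (j < rules × Partial j r)) ⊎ r List.∈ Rs

  open Parsed

  parse-start : ∀ {elem owner concl} → Parsed [] R
    (mkTables 0 0 elem owner concl)
  parse-start = record
    { owner< = λ () ; elem< = λ () ; begun = λ () ; partial = λ () ; indexed = inj₂ }

  parse-done : ∀ {𝕋} → Parsed [] [] 𝕋 → Faithful 𝕋
  parse-done {𝕋} parsed = record
    { rule-of  = λ j<m → map₂ (λ {r} → map₂ (complete r)) (partial parsed j<m)
    ; index-of = λ {r} r∈R → index r (indexed parsed r∈R)
    ; owner<   = owner< parsed
    ; elem<    = elem< parsed }
    where
    open Tables 𝕋
    Represents : ℕ → Rule n → Set
    Represents j (A , q) = concl j ≡ toℕ q
      × (∀ {a} → a ∈ A → Occ occs elem owner j a)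
      × (∀ {a} → Occ occs elem owner j a → a ∈ A)
    complete : ∀ {j} r → Partial parsed j r → Represents j r
    complete _ (c , to , from) = c , (λ a∈A → Sum.[ (λ o → o) , (λ ()) ] (to a∈A)) , from ∘ inj₁
    index : ∀ r → (Σ[ j ∈ ℕ ] (j < rules × Partial parsed j r)) ⊎ r List.∈ [] →
      Σ[ j ∈ ℕ ] (j < rules × Represents j r)
    index r (inj₁ (j , j<m , p)) = j , j<m , complete r p

  module _ {a as Rs occs rules elem owner concl v} (v≡a : v ≡ toℕ a)
    (parsed : Parsed (a ∷ as) Rs
      (mkTables occs rules elem owner concl)) where
    private
      elem′  = elem ⟦ occs ≔ v ⟧
      owner′ = owner ⟦ occs ≔ rules ∸ 1 ⟧
      𝕋′ : Tables
      𝕋′ = mkTables (suc occs) rules elem′ owner′ concl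

      Done Done′ : ℕ → Fin n → Set
      Done  j b = Occ occs elem owner j b ⊎ (j ≡ rules ∸ 1 × b List.∈ a ∷ as)
      Done′ j b = Occ (suc occs) elem′ owner′ j b ⊎ (j ≡ rules ∸ 1 × b List.∈ as)

      -- With `back`: reading `a` moves it from the unread list to occurrence `occs`, so the
      -- premises attributed to each row stay the same.
      forth : ∀ {j b} → Done j b → Done′ j b
      forth (inj₁ (k , k<M , o , e)) = inj₁ (k , m<n⇒m<1+n k<M ,
        trans (≔-other owner (<⇒≢ k<M)) o , trans (≔-other elem (<⇒≢ k<M)) e)
      forth (inj₂ (j≡ , here refl)) = inj₁ (occs , ≤-refl ,
        trans (≔-same owner occs) (sym j≡) , trans (≔-same elem occs) v≡a)
      forth (inj₂ (j≡ , there b∈as)) = inj₂ (j≡ , b∈as)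

      back : ∀ {j b} → Done′ j b → Done j b
      back (inj₂ (j≡ , b∈as)) = inj₂ (j≡ , there b∈as)
      back (inj₁ (k , k<sM , o , e)) with k ≟ occs
      ... | no k≢M = inj₁ (k , ≤∧≢⇒< (≤-pred k<sM) k≢M ,
        trans (sym (≔-other owner k≢M)) o , trans (sym (≔-other elem k≢M)) e)
      ... | yes refl = inj₂ (trans (sym o) (≔-same owner occs) ,
        here (toℕ-injective (trans (sym e) (trans (≔-same elem occs) v≡a))))

    parse-elem : Parsed as Rs 𝕋′
    parse-elem = record
      { owner<  = λ {k} k<sM → ≔-elim (_< rules) owner k (λ _ → begun parsed (here refl))
                    (λ k≢M → owner< parsed (≤∧≢⇒< (≤-pred k<sM) k≢M))
      ; elem<   = λ {k} k<sM → ≔-elim (_< n) elem k (λ _ → subst (_< n) (sym v≡a) (toℕ<n a))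
                    (λ k≢M → elem< parsed (≤∧≢⇒< (≤-pred k<sM) k≢M))
      ; begun   = λ b∈as → begun parsed (there b∈as)
      ; partial = λ j<m → map₂ (map₂ λ { (c , to , from) → c , forth ∘ to , from ∘ back }) (partial parsed j<m)
      ; indexed = λ r∈R → Sum.map₁ (map₂ (map₂ λ { (c , to , from) → c , forth ∘ to , from ∘ back })) (indexed parsed r∈R) }

  module _ {as q r Rs occs rules elem owner concl v} (v≡q : v ≡ toℕ q) (lists : Lists (as , q) r)
    (r∈R : r List.∈ R)
    (parsed : Parsed [] (r ∷ Rs)
      (mkTables occs rules elem owner concl)) where
    private
      concl′ = concl ⟦ rules ≔ v ⟧
      𝕋′ : Tables
      𝕋′ = mkTables occs (suc rules) elem owner concl′

      Partial′ : ℕ → Rule n → Set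
      Partial′ j (A , q) = concl′ j ≡ toℕ q
        × (∀ {a} → a ∈ A → Occ occs elem owner j a ⊎ (j ≡ rules × a List.∈ as))
        × (∀ {a} → Occ occs elem owner j a ⊎ (j ≡ rules × a List.∈ as) → a ∈ A)

      old : ∀ {j} s → j < rules → Partial parsed j s → Partial′ j s
      old s j<m (c , to , from) =
        trans (≔-other concl (<⇒≢ j<m)) c ,
        (λ a∈A → Sum.map₂ (λ ()) (to a∈A) ) ,
        λ { (inj₁ o) → from (inj₁ o) ; (inj₂ (j≡m , _)) → contradiction j≡m (<⇒≢ j<m) }

      new : Partial′ rules r
      new =
        trans (≔-same concl rules) (trans v≡q (cong toℕ (proj₂ (proj₂ lists)))) ,
        (λ {a} a∈A → inj₂ (refl , Equivalence.from (proj₁ (proj₂ lists) a) a∈A)) ,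
        -- No recorded occurrence belongs to the new row, since all owners are below `rules`.
        λ { (inj₁ (k , k<M , o , _)) → contradiction o (<⇒≢ (owner< parsed k<M))
          ; {a} (inj₂ (_ , a∈as)) → Equivalence.to (proj₁ (proj₂ lists) a) a∈as }

    parse-rule : Parsed as Rs 𝕋′
    parse-rule = record
      { owner<  = λ k<M → m<n⇒m<1+n (owner< parsed k<M)
      ; elem<   = elem< parsed
      ; begun   = λ _ → ≤-refl
      ; partial = partial′
      ; indexed = λ {s} s∈R → index s (indexed parsed s∈R) }
      where
      partial′ : ∀ {j} → j < suc rules → Σ[ s ∈ Rule n ] (s List.∈ R × Partial′ j s)
      partial′ {j} j<sm with j ≟ rules
      ... | yes refl = r , r∈R , new
      ... | no j≢m with j<m ← ≤∧≢⇒< (≤-pred j<sm) j≢m with s , s∈R , p ← partial parsed j<m =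
        s , s∈R , old s j<m p
      index : ∀ s → (Σ[ j ∈ ℕ ] (j < rules × Partial parsed j s)) ⊎ s List.∈ r ∷ Rs →
        (Σ[ j ∈ ℕ ] (j < suc rules × Partial′ j s)) ⊎ s List.∈ Rs
      index s (inj₁ (j , j<m , p)) = inj₁ (j , m<n⇒m<1+n j<m , old s j<m p)
      index s (inj₂ (here refl))   = inj₁ (rules , ≤-refl , new)
      index s (inj₂ (there s∈Rs))  = inj₂ s∈Rs

  -- The new row is unmarked, so it contributes `δ v x` in full, matching the increment at `v`.
  counts-add : ∀ {m concl sat cnt v} → (∀ j → sat j ≡ 0) → Counts m concl sat cnt →
    Counts (suc m) (concl ⟦ m ≔ v ⟧) sat (cnt ⟦ v ≔ suc (cnt v) ⟧)
  counts-add {m} {concl} {sat} {cnt} {v} sat≡0 counts x x<n = begin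
    (cnt ⟦ v ≔ suc (cnt v) ⟧) x         ≡⟨ ≔-elim (_≡ δ v x + cnt x) cnt x
                                            (λ { refl → cong (_+ cnt x) (sym (δ-refl v)) })
                                            (λ x≢v → cong (_+ cnt x) (sym (≔-other (λ _ → 0) x≢v))) ⟩
    δ v x + cnt x                       ≡⟨ cong (δ v x +_) (counts x x<n) ⟩
    δ v x + (ban x + old)               ≡⟨ +-assoc (δ v x) (ban x) old ⟨
    δ v x + ban x + old                 ≡⟨ cong (_+ old) (+-comm (δ v x) (ban x)) ⟩
    ban x + δ v x + old                 ≡⟨ +-assoc (ban x) (δ v x) old ⟩
    ban x + (δ v x + old)               ≡⟨ cong (ban x +_) (cong₂ _+_ last≡ rest≡) ⟩
    ban x + ∑ (suc m) (due (concl ⟦ m ≔ v ⟧) sat x) ∎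
    where
    open ≡-Reasoning
    old = ∑ m (due concl sat x)
    last≡ : δ v x ≡ due (concl ⟦ m ≔ v ⟧) sat x m
    last≡ = sym (cong₂ (λ c s → δ c x ∸ s) (≔-same concl m) (sat≡0 m))
    rest≡ : old ≡ ∑ m (due (concl ⟦ m ≔ v ⟧) sat x)
    rest≡ = ∑-cong m λ i i<m → cong (λ c → δ c x ∸ sat i) (sym (≔-other concl (<⇒≢ i<m)))

-- The program and its correctness

-- `rLeft` counts the unread rules and `rRem` the unread premises of the current rule; `rPtr` is a
-- list pointer shifted by one.
rSize rIndex rPos rLeft rRem rRules rOccs rPtr rTop rCur rRule : Reg
rSize  = 0
rIndex = 1
rPos   = 2
rLeft  = 3
rRem   = 4
rRules = 5
rOccs  = 6
rPtr   = 7
rTop   = 8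
rCur   = 9
rRule  = 10

aCnt aElem aOwner aConcl aSat aNext aFirst aStack : Arr
aCnt   = 2
aElem  = 3
aOwner = 4
aConcl = 5
aSat   = 6
aNext  = 7
aFirst = 8
aStack = 9

-- _⊖_ is truncated subtraction: either has the value 0 iff e and f both have,
-- and same is nonzero iff e and f have equal values.
either same : Exp → Exp → Exp
either e f = lit 1 ⊖ (lit 1 ⊖ e ⊖ f)
same   e f = lit 1 ⊖ (e ⊖ f) ⊖ (f ⊖ e)

input : Exp → Exp
input = read inputArr

ruleConcl : Exp
ruleConcl = read aConcl (var rRule)

step : Program
step = rIndex := succ (var rIndex)

mark : Program
mark = aSat [ var rRule ]:= lit 1
     ⨾ aCnt [ ruleConcl ]:= read aCnt ruleConcl ⊖ lit 1

-- `e` is evaluated again after the first store; the arguments used below read neither `outputArr`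
-- nor `aStack`.
push : Exp → Program
push e = outputArr [ e ]:= lit 1
       ⨾ aStack [ var rTop ]:= e
       ⨾ rTop := succ (var rTop)

banBody parseBody linkBody scanBody mainBody : Program

banBody =
    -- Word 0 of the input is `n`, so the bit of element `i` is word `i + 1`.
    aCnt [ var rIndex ]:= lit 1 ⊖ input (succ (var rIndex))
  ⨾ step

parseBody =
  If var rRem
  Then ( aElem [ var rOccs ]:= input (var rPos)
       -- `rRules` was already incremented at the header of the current rule.
       ⨾ aOwner [ var rOccs ]:= var rRules ⊖ lit 1
       ⨾ rOccs := succ (var rOccs)
       ⨾ rRem := var rRem ⊖ lit 1
       ⨾ rPos := succ (var rPos) )
  Else ( aConcl [ var rRules ]:= input (var rPos)
       ⨾ aCnt [ input (var rPos) ]:= succ (read aCnt (input (var rPos)))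
       ⨾ rRules := succ (var rRules)
       ⨾ rRem := input (succ (var rPos))
       ⨾ rLeft := var rLeft ⊖ lit 1
       ⨾ rPos := succ (succ (var rPos)) )

linkBody =
    aNext [ var rIndex ]:= read aFirst (read aElem (var rIndex))
  ⨾ aFirst [ read aElem (var rIndex) ]:= succ (var rIndex)
  ⨾ rRule := read aOwner (var rIndex)
  ⨾ (If same (read aElem (var rIndex)) ruleConcl
     Then (If read aSat (var rRule) Then skip Else mark)
     Else skip)
  ⨾ step

scanBody =
    (If read aCnt (var rIndex) Then skip Else push (var rIndex))
  ⨾ step

mainBody =
  If var rPtr
  Then ( rRule := read aOwner (var rPtr ⊖ lit 1)
       ⨾ rPtr := read aNext (var rPtr ⊖ lit 1)
       ⨾ (If read aSat (var rRule)
          Then skip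
          Else (mark ⨾ (If read aCnt ruleConcl Then skip Else push ruleConcl))) )
  Else ( rTop := var rTop ⊖ lit 1
       ⨾ rCur := read aStack (var rTop)
       ⨾ rPtr := read aFirst (var rCur) )

banTest parseTest linkTest scanTest mainTest : Exp
banTest   = var rSize ⊖ var rIndex
parseTest = either (var rLeft) (var rRem)
linkTest  = var rOccs ⊖ var rIndex
scanTest  = var rSize ⊖ var rIndex
mainTest  = either (var rTop) (var rPtr)

-- It runs with `rIndex` equal to `n`: the bits fill words 1 to `n`, and the number of rules is the
-- word after them.
seekListing : Program
seekListing =
    rPos := succ (var rIndex)
  ⨾ rLeft := input (var rPos)
  ⨾ rPos := succ (var rPos)

closure : Program
closure =
    rSize := input (lit 0)
  ⨾ (While banTest Do banBody)
  ⨾ seekListing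
  ⨾ (While parseTest Do parseBody)
  ⨾ rIndex := lit 0
  ⨾ (While linkTest Do linkBody)
  ⨾ rIndex := lit 0
  ⨾ (While scanTest Do scanBody)
  ⨾ (While mainTest Do mainBody)

either≡0 : ∀ a b → 1 ∸ (1 ∸ a ∸ b) ≡ 0 → a ≡ 0 × b ≡ 0
either≡0 zero    zero    _  = refl , refl
either≡0 zero    (suc b) eq = contradiction (trans (cong (1 ∸_) (sym (0∸n≡0 b))) eq) 1+n≢0
either≡0 (suc a) b       eq =
  contradiction (trans (cong (1 ∸_) (sym (trans (cong (_∸ b) (0∸n≡0 a)) (0∸n≡0 b)))) eq) 1+n≢0

same≢0 : ∀ a b → 1 ∸ (a ∸ b) ∸ (b ∸ a) ≢ 0 → a ≡ b
same≢0 zero    zero    ne = refl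
same≢0 zero    (suc b) ne = contradiction (0∸n≡0 b) ne
same≢0 (suc a) zero    ne = contradiction (0∸n≡0 a) ne
same≢0 (suc a) (suc b) ne = cong suc (same≢0 a b ne)

same-refl : ∀ a → 1 ∸ (a ∸ a) ∸ (a ∸ a) ≢ 0
same-refl a rewrite n∸n≡0 a = λ ()

pred-suc : ∀ {m} → m ≢ 0 → m ≡ suc (m ∸ 1)
pred-suc {zero}  ne = contradiction refl ne
pred-suc {suc m} ne = refl

module Correctness {n} (R : List (Rule n)) (X : Subset n) (n≤size : n ≤ inputSize R)
  (L : Listing n) (pres : Presents L R) where

  word : ℕ → ℕ
  word = wordAt (encode L X)

  ban : ℕ → ℕ
  ban x = 1 ∸ word (suc x)

  ban-X : ∀ i → ban (toℕ i) ≡ 1 ∸ bit (lookup X i)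
  ban-X i = cong (1 ∸_) (wordAt-bits X _ i)

  word-listing : ∀ i → word (suc n + i) ≡ wordAt (length L ∷ concatMap encodeRule L) i
  word-listing i = wordAt-after X (length L ∷ concatMap encodeRule L) i

  open Invariants R X ban ban-X
  open Parsing R X ban ban-X

  -- Loop invariants and their preservation

  tables : State → Tables
  tables σ = mkTables (reg σ rOccs) (reg σ rRules) (arr σ aElem) (arr σ aOwner) (arr σ aConcl)

  Untouched : State → Set
  Untouched σ = (∀ x → arr σ outputArr x ≡ 0) × (∀ j → arr σ aSat j ≡ 0)
    × (∀ x → arr σ aFirst x ≡ 0) × reg σ rTop ≡ 0 × reg σ rPtr ≡ 0

  InputReady : State → Set
  InputReady σ = (∀ i → arr σ inputArr i ≡ word i) × reg σ rSize ≡ n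

  Decreased : (ℕ → State → Set) → ℕ → State → Set
  Decreased Inv B τ = Σ[ B′ ∈ ℕ ] (B′ < B × Inv B′ τ)

  BanInv : ℕ → State → Set
  BanInv B σ = InputReady σ × Untouched σ
    × reg σ rRem ≡ 0 × reg σ rRules ≡ 0 × reg σ rOccs ≡ 0
    × reg σ rIndex + B ≡ n
    × (∀ x → x < reg σ rIndex → arr σ aCnt x ≡ ban x)

  count-down : ∀ {B i limit} → i + B ≡ limit → limit ∸ i ≢ 0 → Σ[ B′ ∈ ℕ ] (B′ < B × suc i + B′ ≡ limit)
  count-down {zero}  {i} refl go rewrite +-identityʳ i | n∸n≡0 i = contradiction refl go
  count-down {suc B} {i} eq   go = B , ≤-refl , trans (sym (+-suc i B)) eq

  count-done : ∀ {B i limit} → i + B ≡ limit → limit ∸ i ≡ 0 → i ≡ limit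
  count-done {B} {i} eq stop = ≤-antisym (≤-trans (m≤m+n i B) (≤-reflexive eq)) (m∸n≡0⇒m≤n stop)

  ban-body : ∀ B σ → BanInv B σ → eval banTest σ ≢ 0 → Runs 20 banBody σ (Decreased BanInv B)
  ban-body B σ ((inp , size) , fresh , rem , rules , occs , idx , bans) go
    with B′ , B′<B , idx′ ← count-down idx (subst (λ s → s ∸ reg σ rIndex ≢ 0) size go) =
    -- The cost along an execution path is a closed numeral, so the generous bound 20 is checked by
    -- computation; the other loop bodies are treated alike.
    _ , _ , ⇓seq ⇓store ⇓assign , ≤ᵇ⇒≤ _ _ _ ,
    B′ , B′<B , (inp , size) , fresh , rem , rules , occs , idx′ ,
    λ x x<si → ≔-elim (_≡ ban x) (arr σ aCnt) x
      (λ { refl → cong (1 ∸_) (inp (suc x)) })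
      (λ x≢i → bans x (≤∧≢⇒< (≤-pred x<si) x≢i))

  -- The variant is the workload, and the closing inequality bounds the number of occurrences by the
  -- input size when the loop ends.
  ParseInv : ℕ → State → Set
  ParseInv B σ = InputReady σ × Untouched σ ×
    Σ[ as ∈ List (Fin n) ] Σ[ Ls ∈ Listing n ] Σ[ Rs ∈ List (Rule n) ]
      ( (∀ i → word (reg σ rPos + i) ≡ wordAt (map toℕ as ++ concatMap encodeRule Ls) i)
      × reg σ rRem ≡ length as × reg σ rLeft ≡ length Ls
      × Presents Ls Rs × (∀ {r} → r List.∈ Rs → r List.∈ R)
      × Parsed as Rs (tables σ)
      × Counts (reg σ rRules) (arr σ aConcl) (arr σ aSat) (arr σ aCnt)
      × workload as Ls ≡ B × reg σ rOccs + B ≤ inputSize R )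

  parse-body : ∀ B σ → ParseInv B σ → eval parseTest σ ≢ 0 → Runs 60 parseBody σ (Decreased ParseInv B)
  parse-body B σ (ready , fresh , [] , [] , Rs , unread , rem , left , _) go =
    contradiction (cong₂ (λ a b → 1 ∸ (1 ∸ a ∸ b)) left rem) go
  parse-body B σ ((inp , size) , fresh , a ∷ as , Ls , Rs , unread , rem , left , prs , Rs⊆R , parsed , counts , refl , size≤) go =
    _ , _ , ⇓then (subst (_≢ 0) (sym rem) λ ())
      (⇓seq ⇓store (⇓seq ⇓store (⇓seq ⇓assign (⇓seq ⇓assign ⇓assign)))) , ≤ᵇ⇒≤ _ _ _ ,
    workload as Ls , workload-step Ls , (inp , size) , fresh , as , Ls , Rs ,
    (λ i → trans (cong word (sym (+-suc _ i))) (unread (suc i))) ,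
    cong (_∸ 1) rem , left , prs , Rs⊆R , parse-elem here-a parsed , counts , refl ,
    ≤-trans (≤-trans (≤-reflexive (sym (+-suc _ _))) (+-monoʳ-≤ (reg σ rOccs) (workload-step Ls))) size≤
    where
    workload-step : ∀ Ls → workload as Ls < workload (a ∷ as) Ls
    workload-step []       = ≤-refl
    workload-step (_ ∷ Ls) = ≤-refl
    here-a : arr σ inputArr (reg σ rPos) ≡ toℕ a
    here-a = trans (inp (reg σ rPos)) (trans (cong word (sym (+-identityʳ (reg σ rPos)))) (unread 0))
  parse-body B σ ((inp , size) , fresh , [] , (as , q) ∷ Ls , r ∷ Rs , unread , rem , left , lists ∷ prs , Rs⊆R , parsed , counts , refl , size≤) go =
    _ , _ , ⇓else rem
      (⇓seq ⇓store (⇓seq ⇓store (⇓seq ⇓assign (⇓seq ⇓assign (⇓seq ⇓assign ⇓assign))))) , ≤ᵇ⇒≤ _ _ _ ,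
    workload as Ls , ≤-refl , (inp , size) , fresh , as , Ls , Rs ,
    (λ i → trans (cong word (trans (cong suc (sym (+-suc _ i))) (sym (+-suc _ (suc i))))) (unread (suc (suc i)))) ,
    trans (inp _) (trans (cong word (+-comm 1 _)) (unread 1)) ,
    cong (_∸ 1) left , prs , Rs⊆R ∘ there ,
    parse-rule here-q lists (Rs⊆R (here refl)) parsed ,
    counts-add (proj₁ (proj₂ fresh)) counts ,
    refl , ≤-trans (+-monoʳ-≤ (reg σ rOccs) (n≤1+n _)) size≤
    where
    here-q : arr σ inputArr (reg σ rPos) ≡ toℕ q
    here-q = trans (inp (reg σ rPos)) (trans (cong word (sym (+-identityʳ (reg σ rPos)))) (unread 0))

  LinkInv : ℕ → State → Set
  LinkInv B σ = reg σ rSize ≡ n × Faithful (tables σ) × reg σ rOccs ≤ inputSize R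
    × (∀ x → arr σ outputArr x ≡ 0) × reg σ rTop ≡ 0 × reg σ rPtr ≡ 0
    × reg σ rIndex + B ≡ reg σ rOccs
    × Linked (reg σ rIndex) (arr σ aElem) (arr σ aFirst) (arr σ aNext)
    × RuleState (tables σ) (arr σ aSat) (arr σ aCnt) (arr σ outputArr)
    × Selfs (tables σ) (reg σ rIndex) (arr σ aSat)

  link-body : ∀ B σ → LinkInv B σ → eval linkTest σ ≢ 0 → Runs 80 linkBody σ (Decreased LinkInv B)
  link-body B σ (size , faithful , occs≤ , out≡0 , top , ptr , idx , linked , st , selfs) go
    with B′ , B′<B , idx′ ← count-down idx go
    with i<M ← ≤-trans (s≤s (m≤m+n (reg σ rIndex) B′)) (≤-reflexive idx′)
    -- `rRule` is replaced by the value the body gives it, so the test can be evaluated in `σ`; the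
    -- stores before it do not touch the arrays it reads.
    with eval (same (read aElem (var rIndex)) (read aConcl (read aOwner (var rIndex)))) σ ≟ 0
  ... | yes differ =
    _ , _ , ⇓seq ⇓store (⇓seq ⇓store (⇓seq ⇓assign (⇓seq (⇓else differ ⇓skip) ⇓assign))) , ≤ᵇ⇒≤ _ _ _ ,
    B′ , B′<B , size , faithful , occs≤ , out≡0 , top , ptr , idx′ , link linked , st ,
    λ k k<si eq → selfs k (≤∧≢⇒< (≤-pred k<si)
      λ { refl → same-refl (arr σ aElem k) (trans (cong (λ c → 1 ∸ (arr σ aElem k ∸ c) ∸ (c ∸ arr σ aElem k)) eq) differ) }) eq
  ... | no agree with arr σ aSat (arr σ aOwner (reg σ rIndex)) ≟ 0
  ...   | no satisfied =
    _ , _ , ⇓seq ⇓store (⇓seq ⇓store (⇓seq ⇓assign (⇓seq (⇓then agree (⇓then satisfied ⇓skip)) ⇓assign))) , ≤ᵇ⇒≤ _ _ _ ,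
    B′ , B′<B , size , faithful , occs≤ , out≡0 , top , ptr , idx′ , link linked , st ,
    selfs′
    where
    selfs′ : Selfs (tables σ) (suc (reg σ rIndex)) (arr σ aSat)
    selfs′ k k<si eq with k ≟ reg σ rIndex
    ... | yes refl = satisfied
    ... | no k≢i = selfs k (≤∧≢⇒< (≤-pred k<si) k≢i) eq
  ...   | yes unsatisfied =
    _ , _ , ⇓seq ⇓store (⇓seq ⇓store (⇓seq ⇓assign (⇓seq (⇓then agree (⇓else unsatisfied (⇓seq ⇓store ⇓store))) ⇓assign))) , ≤ᵇ⇒≤ _ _ _ ,
    B′ , B′<B , size , faithful , occs≤ , out≡0 , top , ptr , idx′ , link linked ,
    hit faithful (Faithful.owner< faithful i<M) unsatisfied
      -- The current occurrence is the premise that equals the conclusion.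
      (reg σ rIndex , i<M , refl , inj₂ (same≢0 _ _ agree)) st ,
    selfs′
    where
    sat′ = arr σ aSat ⟦ arr σ aOwner (reg σ rIndex) ≔ 1 ⟧
    selfs′ : Selfs (tables σ) (suc (reg σ rIndex)) sat′
    selfs′ k k<si eq with k ≟ reg σ rIndex
    ... | yes refl = λ s → 1+n≢0 (trans (sym (≔-same (arr σ aSat) _)) s)
    ... | no k≢i = ≔-mark (arr σ aSat) _ (selfs k (≤∧≢⇒< (≤-pred k<si) k≢i) eq)

  -- The last clause, that everything in the output is still on the stack, supplies `pending` when
  -- the main loop starts.
  ScanInv : ℕ → State → Set
  ScanInv B σ = reg σ rSize ≡ n × Faithful (tables σ) × reg σ rOccs ≤ inputSize R
    × Linked (reg σ rOccs) (arr σ aElem) (arr σ aFirst) (arr σ aNext)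
    × RuleState (tables σ) (arr σ aSat) (arr σ aCnt) (arr σ outputArr)
    × Selfs (tables σ) (reg σ rOccs) (arr σ aSat)
    × Work (tables σ) (arr σ outputArr) (arr σ aStack) (reg σ rTop)
    × reg σ rPtr ≡ 0
    × reg σ rIndex + B ≡ n
    × (∀ x → x < reg σ rIndex → arr σ outputArr x ≡ 1 ∸ arr σ aCnt x)
    × (∀ x → reg σ rIndex ≤ x → arr σ outputArr x ≡ 0)
    × (∀ x → arr σ outputArr x ≢ 0 → Σ[ i ∈ ℕ ] (i < reg σ rTop × arr σ aStack i ≡ x))

  scan-body : ∀ B σ → ScanInv B σ → eval scanTest σ ≢ 0 → Runs 40 scanBody σ (Decreased ScanInv B)
  scan-body B σ (size , faithful , occs≤ , linked , st , selfs , work , ptr , idx , below , above , onStack) go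
    with B′ , B′<B , idx′ ← count-down idx (subst (λ s → s ∸ reg σ rIndex ≢ 0) size go)
    with arr σ aCnt (reg σ rIndex) ≟ 0
  ... | no counted =
    _ , _ , ⇓seq (⇓then counted ⇓skip) ⇓assign , ≤ᵇ⇒≤ _ _ _ ,
    B′ , B′<B , size , faithful , occs≤ , linked , st , selfs , work , ptr , idx′ ,
    below′ , (λ x i<x → above x (<⇒≤ i<x)) , onStack
    where
    below′ : ∀ x → x < suc (reg σ rIndex) → arr σ outputArr x ≡ 1 ∸ arr σ aCnt x
    below′ x x<si with x ≟ reg σ rIndex
    ... | yes refl = trans (above x ≤-refl) (sym (1∸m≡0 counted))
    ... | no x≢i = below x (≤∧≢⇒< (≤-pred x<si) x≢i)
  ... | yes ready =
    _ , _ , ⇓seq (⇓else ready (⇓seq ⇓store (⇓seq ⇓store ⇓assign))) ⇓assign , ≤ᵇ⇒≤ _ _ _ ,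
    B′ , B′<B , size , faithful , occs≤ , linked , ruleState-push faithful i st , selfs ,
    work-push faithful st i<n (above i ≤-refl) ready work , ptr , idx′ ,
    (λ x x<si → ≔-elim (_≡ 1 ∸ arr σ aCnt x) out x
      (λ { refl → sym (cong (1 ∸_) ready) })
      (λ x≢i → below x (≤∧≢⇒< (≤-pred x<si) x≢i))) ,
    (λ x i<x → trans (≔-other out (<⇒≢ i<x ∘ sym)) (above x (<⇒≤ i<x))) ,
    onStack′
    where
    i = reg σ rIndex
    out = arr σ outputArr
    top = reg σ rTop
    i<n : i < n
    i<n = ≤-trans (s≤s (m≤m+n i B′)) (≤-reflexive idx′)
    onStack′ : ∀ x → (out ⟦ i ≔ 1 ⟧) x ≢ 0 → Σ[ s ∈ ℕ ] (s < suc top × (arr σ aStack ⟦ top ≔ i ⟧) s ≡ x)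
    onStack′ x ne with x ≟ i
    ... | yes refl = top , ≤-refl , ≔-same (arr σ aStack) top
    ... | no x≢i with s , s<top , eq ← onStack x (subst (_≢ 0) (≔-other out x≢i) ne) =
      s , m<n⇒m<1+n s<top , trans (≔-other (arr σ aStack) (<⇒≢ s<top)) eq

  -- `top` and `ptr` come last so that they can be rewritten to a successor or to 0, as the step
  -- lemmas require.
  LoopAt : (sat cnt out stack : ℕ → ℕ) (cur : ℕ) → Tables → ℕ → ℕ → ℕ → Set
  LoopAt sat cnt out stack cur 𝕋 B top ptr =
    Loop 𝕋 sat cnt out stack top ptr cur × measure 𝕋 out stack top ptr cur ≡ B

  MainInv : ℕ → State → Set
  MainInv B σ = Faithful (tables σ)
    × Linked (reg σ rOccs) (arr σ aElem) (arr σ aFirst) (arr σ aNext)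
    × LoopAt (arr σ aSat) (arr σ aCnt) (arr σ outputArr) (arr σ aStack) (reg σ rCur)
             (tables σ) B (reg σ rTop) (reg σ rPtr)

  main-body : ∀ B σ → MainInv B σ → eval mainTest σ ≢ 0 → Runs 80 mainBody σ (Decreased MainInv B)
  main-body B σ (faithful , linked , inv) go with reg σ rPtr ≟ 0
  ... | yes ptr≡0
    -- The test is nonzero and the pointer is null, so the stack is not empty.
    with inv′ , refl ← subst₂ (LoopAt _ _ _ _ _ (tables σ) B)
           (pred-suc (λ top≡0 → go (cong₂ (λ a b → 1 ∸ (1 ∸ a ∸ b)) top≡0 ptr≡0))) ptr≡0 inv
    with inv″ , decrease ← loop-pop faithful linked inv′ =
    _ , _ , ⇓else ptr≡0 (⇓seq ⇓assign (⇓seq ⇓assign ⇓assign)) , ≤ᵇ⇒≤ _ _ _ ,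
    _ , decrease , faithful , linked , inv″ , refl
  ... | no ptr≢0
    with inv′ , refl ← subst (LoopAt _ _ _ _ _ (tables σ) B _) (pred-suc ptr≢0) inv
    with arr σ aSat (arr σ aOwner (reg σ rPtr ∸ 1)) ≟ 0
  ...   | no satisfied with inv″ , decrease ← loop-skip faithful linked inv′ satisfied =
    _ , _ , ⇓then ptr≢0 (⇓seq ⇓assign (⇓seq ⇓assign (⇓then satisfied ⇓skip))) , ≤ᵇ⇒≤ _ _ _ ,
    _ , decrease , faithful , linked , inv″ , refl
  ...   | yes unsatisfied
    with (arr σ aCnt ⟦ _ ≔ arr σ aCnt _ ∸ 1 ⟧) (arr σ aConcl (arr σ aOwner (reg σ rPtr ∸ 1))) ≟ 0
  ...     | no more with inv″ , decrease ← loop-hit faithful linked inv′ unsatisfied more =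
    _ , _ , ⇓then ptr≢0 (⇓seq ⇓assign (⇓seq ⇓assign (⇓else unsatisfied
      (⇓seq (⇓seq ⇓store ⇓store) (⇓then more ⇓skip))))) , ≤ᵇ⇒≤ _ _ _ ,
    _ , decrease , faithful , linked , inv″ , refl
  ...     | yes none with inv″ , decrease ← loop-push faithful linked inv′ unsatisfied none =
    _ , _ , ⇓then ptr≢0 (⇓seq ⇓assign (⇓seq ⇓assign (⇓else unsatisfied
      (⇓seq (⇓seq ⇓store ⇓store) (⇓else none (⇓seq ⇓store (⇓seq ⇓store ⇓assign))))))) , ≤ᵇ⇒≤ _ _ _ ,
    _ , decrease , faithful , linked , inv″ , refl

  -- Composing the phases within a linear bound

  size : ℕ
  size = inputSize R

  Answer : State → Set
  Answer τ = Σ[ Z ∈ Subset n ] (IsMaximumIn R X Z × Outputs τ Z)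

  -- A record, because type checking would otherwise unfold the product k * suc size.
  record Linear (k : ℕ) (p : Program) (σ : State) (Q : State → Set) : Set where
    constructor linear
    field runs : Runs (k * suc size) p σ Q

  c*1+2m≤2c*1+m : ∀ c m → c * suc (m + m) ≤ (c + c) * suc m
  c*1+2m≤2c*1+m c m = begin
    c * suc (m + m)       ≤⟨ *-monoʳ-≤ c (s≤s (+-monoʳ-≤ m (n≤1+n m))) ⟩
    c * (suc m + suc m)   ≡⟨ *-distribˡ-+ c (suc m) (suc m) ⟩
    c * suc m + c * suc m ≡⟨ *-distribʳ-+ (suc m) c c ⟨
    (c + c) * suc m       ∎
    where open ≤-Reasoning

  linear-while : ∀ {T e p} Inv → (∀ B σ → Inv B σ → eval e σ ≢ 0 → Runs T p σ (Decreased Inv B)) →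
    ∀ B σ → B ≤ size → Inv B σ →
    Linear (1 + cost e + T) (While e Do p) σ (λ τ → Σ[ B′ ∈ ℕ ] (Inv B′ τ × eval e τ ≡ 0))
  linear-while Inv body B σ B≤ inv = linear (runs-while Inv body B σ B≤ inv)

  -- The variant may reach twice `size`, one share for the elements and one for the occurrences, so
  -- the cost per iteration is counted twice.
  linear-main : ∀ {B} σ → B ≤ size + size → MainInv B σ →
    Linear ((1 + cost mainTest + 80) + (1 + cost mainTest + 80)) (While mainTest Do mainBody) σ Answer
  linear-main {B} σ B≤ inv
    with t , τ , ⇓τ , t≤ , B′ , (faithful , linked , loop , _) , stop ← runs-while MainInv main-body B σ B≤ inv
    with top≡0 , ptr≡0 ← either≡0 (reg τ rTop) (reg τ rPtr) stop =
    linear (t , τ , ⇓τ , ≤-trans t≤ (c*1+2m≤2c*1+m (1 + cost mainTest + 80) size) ,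
      loop-result faithful (subst₂ (λ top ptr → Loop (tables τ) _ _ _ _ top ptr (reg τ rCur)) top≡0 ptr≡0 loop))

  linear-seq : ∀ {j k p q σ P Q} → Linear j p σ P →
    (∀ τ → P τ → Linear k q τ Q) → Linear (j + k) (p ⨾ q) σ Q
  linear-seq {j} {k} (linear first) after
    with t , τ , ⇓τ , t≤ , post ← runs-seq first (λ τ Pτ → Linear.runs (after τ Pτ)) =
    linear (t , τ , ⇓τ , ≤-trans t≤ (≤-reflexive (sym (*-distribʳ-+ (suc size) j k))) , post)

  linear-assign : ∀ {x e σ} {Q : State → Set} → Q ⟪ reg σ ⟦ x ≔ eval e σ ⟧ , arr σ ⟫ →
    Linear (1 + cost e) (x := e) σ Q
  linear-assign post = linear (_ , _ , ⇓assign , m≤m*n _ (suc size) , post)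

  ban⇒parse : ∀ {B} τ → BanInv B τ → eval banTest τ ≡ 0 →
    Linear 9 seekListing τ
      (λ υ → ParseInv (workload [] L) υ)
  ban⇒parse τ ((inp , size≡) , fresh , rem , rules , occs , idx , bans) stop =
    -- Equality with an explicit state as postcondition executes the assignments symbolically.
    linear-seq (linear-assign {Q = _≡ τ₁} refl) λ { _ refl →
    linear-seq (linear-assign {Q = _≡ τ₂} refl) λ { _ refl →
    linear-assign
      ( (inp , size≡) , fresh , [] , L , R
      , (λ k → trans (cong word (trans (cong (λ i → suc (suc i) + k) i≡n) (sym (cong suc (+-suc n k))))) (word-listing (suc k)))
      , rem , trans (inp _) (trans (cong word (trans (cong suc i≡n) (sym (+-identityʳ _)))) (word-listing 0))
      , pres , (λ r∈R → r∈R)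
      , subst₂ (λ o r → Parsed [] R (mkTables o r _ _ _)) (sym occs) (sym rules) parse-start
      , subst (λ r → Counts r (arr τ aConcl) (arr τ aSat) (arr τ aCnt)) (sym rules)
          (λ x x<n → trans (bans x (subst (x <_) (sym i≡n) x<n)) (sym (+-identityʳ _)))
      , refl , subst (λ o → o + _ ≤ size) (sym occs) (workload-bound pres) ) } }
    where
    τ₁ τ₂ : State
    τ₁ = ⟪ reg τ ⟦ rPos ≔ suc (reg τ rIndex) ⟧ , arr τ ⟫
    τ₂ = ⟪ reg τ₁ ⟦ rLeft ≔ arr τ inputArr (reg τ₁ rPos) ⟧ , arr τ ⟫
    i≡n : reg τ rIndex ≡ n
    i≡n = count-done idx (trans (cong (_∸ reg τ rIndex) (sym size≡)) stop)

  parse⇒link : ∀ {B} τ → ParseInv B τ → eval parseTest τ ≡ 0 →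
    Linear 2 (rIndex := lit 0) τ (λ υ → LinkInv (reg υ rOccs) υ)
  parse⇒link τ inv stop with either≡0 (reg τ rLeft) (reg τ rRem) stop
  parse⇒link τ (_ , _ , _ ∷ _ , _ , _ , _ , rem , _) stop | _ , rem≡0 = contradiction (trans (sym rem) rem≡0) 1+n≢0
  parse⇒link τ (_ , _ , [] , _ ∷ _ , _ , _ , _ , left , _) stop | left≡0 , _ = contradiction (trans (sym left) left≡0) 1+n≢0
  parse⇒link τ ((_ , size≡) , (out≡0 , sat≡0 , first≡0 , top , ptr) , [] , [] , [] , _ , _ , _ , [] , _ , parsed , counts , _ , occs≤) stop | _ =
    linear-assign
      ( size≡ , parse-done parsed , ≤-trans (m≤m+n _ _) occs≤ , out≡0 , top , ptr , refl
      , ((λ x → record { bound = ≤-reflexive (first≡0 x) ; later = λ _ ()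
                       ; value = λ k eq → contradiction (trans (sym eq) (first≡0 x)) 1+n≢0 }) , λ _ ())
      , record { counts = counts ; hits = λ j _ sat≢0 → contradiction (sat≡0 j) sat≢0 }
      , λ _ () )

  link⇒scan : ∀ {B} τ → LinkInv B τ → eval linkTest τ ≡ 0 →
    Linear 2 (rIndex := lit 0) τ (λ υ → ScanInv n υ)
  link⇒scan τ (size≡ , faithful , occs≤ , out≡0 , top , ptr , idx , linked , st , selfs) stop =
    linear-assign
      ( size≡ , faithful , occs≤
      , subst (λ b → Linked b (arr τ aElem) (arr τ aFirst) (arr τ aNext)) i≡M linked
      , st , subst (λ b → Selfs (tables τ) b (arr τ aSat)) i≡M selfs
      , record
          { reached = Subset.⊥ , start , (λ i∈⊥ → contradiction i∈⊥ ∉⊥) ,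
              λ i → trans (out≡0 _) (cong bit (sym (lookup-replicate i _)))
          ; stacked = λ i i<top → contradiction (subst (i <_) top i<top) λ ()
          ; bounded = bounded }
      , ptr , refl , (λ _ ()) , (λ x _ → out≡0 x) , λ x ne → contradiction (out≡0 x) ne )
    where
    i≡M : reg τ rIndex ≡ reg τ rOccs
    i≡M = count-done idx stop
    -- Nothing is marked and the stack is empty, so the potential is the total load, which double
    -- counting bounds.
    bounded : potential (tables τ) (arr τ outputArr) (arr τ aStack) (reg τ rTop) ≤ n + reg τ rOccs
    bounded = begin
      ∑ n (λ x → (1 ∸ arr τ outputArr x) * load (tables τ) x) + ∑ (reg τ rTop) (load (tables τ) ∘ arr τ aStack)
        ≡⟨ cong₂ _+_
             (∑-cong n {g = load (tables τ)} λ x _ → trans (cong (λ o → (1 ∸ o) * load (tables τ) x) (out≡0 x)) (*-identityˡ _))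
             (cong (λ t → ∑ t (load (tables τ) ∘ arr τ aStack)) top) ⟩
      ∑ n (load (tables τ)) + 0                              ≡⟨ +-identityʳ _ ⟩
      ∑ n (load (tables τ))                                  ≡⟨ ∑-suc n _ ⟩
      n + ∑ n (occurrences (arr τ aElem) (reg τ rOccs))      ≤⟨ +-monoʳ-≤ n (∑-occurrences n (arr τ aElem) (reg τ rOccs)) ⟩
      n + reg τ rOccs                                        ∎
      where open ≤-Reasoning

  scan⇒main : ∀ {B} τ → ScanInv B τ → eval scanTest τ ≡ 0 → Σ[ B′ ∈ ℕ ] (B′ ≤ size + size × MainInv B′ τ)
  scan⇒main τ (size≡ , faithful , occs≤ , linked , st , selfs , work , ptr , idx , below , above , onStack) stop =
    _ , measure≤ , faithful , linked , record
      { ruleState = st ; selfs = selfs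
      ; outs = λ x x<n → below x (subst (x <_) (sym i≡n) x<n)
      ; work = work
      ; pending = λ k _ ne → inj₂ (inj₁ (onStack (arr τ aElem k) ne))
      ; ptr≤ = ≤-trans (≤-reflexive ptr) z≤n
      ; ptr-elem = λ k eq → contradiction (trans (sym eq) ptr) 1+n≢0
      ; ptr-out = λ ne → contradiction ptr ne } , refl
    where
    i≡n : reg τ rIndex ≡ n
    i≡n = count-done idx (trans (cong (_∸ reg τ rIndex) (sym size≡)) stop)
    pot = potential (tables τ) (arr τ outputArr) (arr τ aStack) (reg τ rTop)
    measure≤ : measure (tables τ) (arr τ outputArr) (arr τ aStack) (reg τ rTop) (reg τ rPtr) (reg τ rCur) ≤ size + size
    measure≤ = begin
      pot + ∑ (reg τ rPtr) chain ≡⟨ cong (λ p → pot + ∑ p chain) ptr ⟩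
      pot + 0                    ≡⟨ +-identityʳ pot ⟩
      pot                        ≤⟨ Work.bounded work ⟩
      n + reg τ rOccs            ≤⟨ +-mono-≤ n≤size occs≤ ⟩
      size + size                ∎
      where
      open ≤-Reasoning
      chain = λ k → δ (arr τ aElem k) (reg τ rCur)

  -- The constant adds up the phases: 3 + 24 + 9 + 68 + 2 + 84 + 2 + 44 + 176.
  closure-correct : Linear 412 closure (initial (encode L X)) Answer
  closure-correct =
    linear-seq (linear-assign {Q = BanInv n}
      (((λ _ → refl) , refl) , ((λ _ → refl) , (λ _ → refl) , (λ _ → refl) , refl , refl)
      , refl , refl , refl , refl , λ _ ())) λ σ₁ inv₁ →
    linear-seq (linear-while BanInv ban-body n σ₁ n≤size inv₁) λ { σ₂ (_ , inv₂ , stop₂) →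
    linear-seq (ban⇒parse σ₂ inv₂ stop₂) λ σ₃ inv₃ →
    linear-seq (linear-while ParseInv parse-body _ σ₃ (workload-bound pres) inv₃) λ { σ₄ (_ , inv₄ , stop₄) →
    linear-seq (parse⇒link σ₄ inv₄ stop₄) λ σ₅ inv₅ →
    linear-seq (linear-while LinkInv link-body _ σ₅ (proj₁ (proj₂ (proj₂ inv₅))) inv₅) λ { σ₆ (_ , inv₆ , stop₆) →
    linear-seq (link⇒scan σ₆ inv₆ stop₆) λ σ₇ inv₇ →
    linear-seq (linear-while ScanInv scan-body _ σ₇ n≤size inv₇) λ { σ₈ (_ , inv₈ , stop₈) →
    linear-main σ₈ (proj₁ (proj₂ (scan⇒main σ₈ inv₈ stop₈))) (proj₂ (proj₂ (scan⇒main σ₈ inv₈ stop₈))) } } } }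

  conclude : ∀ {p c} → Linear c p (initial (encode L X)) Answer →
    Σ[ Z ∈ Subset n ] (IsMaximumIn R X Z
      × (Σ[ t ∈ ℕ ] Σ[ τ ∈ State ]
          (⟨ p , initial (encode L X) ⟩⇓[ t ] τ
           × Outputs τ Z
           × t ≤ c * suc (inputSize R))))
  conclude (linear (t , τ , ⇓τ , t≤ , Z , maximum , outputs)) = Z , maximum , t , τ , ⇓τ , outputs , t≤

theorem3p3 : Σ[ p ∈ Program ] Σ[ c ∈ ℕ ]
    (∀ (n : ℕ) (R : List (Rule n)) (X : Subset n) →
    Unique R → n ≤ inputSize R →
    ∀ (L : Listing n) → Presents L R →
    Σ[ Z ∈ Subset n ] (IsMaximumIn R X Z
    × (Σ[ t ∈ ℕ ] Σ[ τ ∈ State ]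
    (⟨ p , initial (encode L X) ⟩⇓[ t ] τ
    × Outputs τ Z
    × t ≤ c * suc (inputSize R)))))
theorem3p3 = closure , 412 , λ n R X _ n≤size L pres →
  Correctness.conclude R X n≤size L pres (Correctness.closure-correct R X n≤size L pres)
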